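{- Let $q$, $a$ and $b$ be integers such that $q \geq 2$, $a \geq 1$ and $b \geq -a$, and let $(v_n)_{n \in \mathbb{N}}$ be the sequence of natural numbers whose general term is $v_n = a q^n + b$ for all $n \in \mathbb{N}$. Suppose that $\gcd(a q, b) = \gcd(a + b, q - 1) = 1$ and set $$A' := \max\left(0, \frac{b}{2 a} + \frac{1}{2 a (q - 1)}\right).$$ Then, for any positive integer $n$, we have $$\mathrm{lcm}\{v_1, v_2, \dots, v_n\} \geq (a q + b) \left(\frac{a (q - 1) + 1}{\sqrt{a (q - 1)}\,(A' + 1)}\right)^{n - 1} q^{\frac{(n - 1)(n - 4)}{4}}.$$
   Context: $\mathbb{N}$ is the set of non-negative integers. -}

module Defs where

open import Algebra.Properties.CommutativeSemiring.Exp using (^-distrib-*)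
open import Algebra.Bundles using (module CommutativeRing)
open import Data.Integer as ℤ using (ℤ; +_; -[1+_])
import Data.Integer.Properties as ℤ
import Data.Nat.Coprimality as Coprimality
open import Data.List using (foldr; applyUpTo)
open import Data.Nat as ℕ using (ℕ; zero; suc)
import Data.Nat.LCM as ℕ
import Data.Nat.Properties as ℕ
open import Data.Product using (∃-syntax; _×_; _,_; proj₁; proj₂)
open import Data.Rational
open import Data.Rational.Properties
open import Data.Rational.Unnormalised as ℚᵘ using (mkℚᵘ; *≡*)
import Data.Rational.Unnormalised.Properties as ℚᵘ
open import Data.Rational.Solver using (module +-*-Solver)
open import Data.Sum using (_⊎_; inj₁; inj₂)
open import Function using (case_of_)
open import Relation.Binary.PropositionalEquality
open import Relation.Nullary using (yes; no; contradiction)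

open import Algebra.Definitions.RawSemiring +-*-rawSemiring public using (_^_)

private
  variable
    p r s t c : ℚ

_/1 : ℤ → ℚ
i /1 = i / 1

2ℚ : ℚ
2ℚ = + 2 / 1

abstract

  i/1>0 : ∀ {i} → + 0 ℤ.< i → 0ℚ < i /1
  i/1>0 {+ suc n} _ = positive⁻¹ ((+ suc n) / 1) {{normalize-pos (suc n) 1}}
  i/1>0 {+ zero} (ℤ.+<+ ())

  0<1ℚ : 0ℚ < 1ℚ
  0<1ℚ = positive⁻¹ 1ℚ

  1<2 : 1ℚ < 2ℚ
  1<2 = *<* (ℤ.+<+ (ℕ.s≤s (ℕ.s≤s ℕ.z≤n)))

  *-pos : 0ℚ < p → 0ℚ < r → 0ℚ < p * r
  *-pos {p} {r} 0<p 0<r =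
    positive⁻¹ (p * r) {{pos*pos⇒pos p {{positive 0<p}} r {{positive 0<r}}}}

  *-monoˡ-≤ : ∀ t → 0ℚ ≤ t → p ≤ r → t * p ≤ t * r
  *-monoˡ-≤ t 0≤t = *-monoˡ-≤-nonNeg t {{nonNegative 0≤t}}

  *-monoʳ-≤ : ∀ t → 0ℚ ≤ t → p ≤ r → p * t ≤ r * t
  *-monoʳ-≤ t 0≤t = *-monoʳ-≤-nonNeg t {{nonNegative 0≤t}}

  *-monoˡ-< : ∀ t → 0ℚ < t → p < r → t * p < t * r
  *-monoˡ-< t 0<t = *-monoʳ-<-pos t {{positive 0<t}}

  *-monoʳ-< : ∀ t → 0ℚ < t → p < r → p * t < r * t
  *-monoʳ-< t 0<t = *-monoˡ-<-pos t {{positive 0<t}}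

  *-mono-≤ : 0ℚ ≤ p → 0ℚ ≤ s → p ≤ r → s ≤ t → p * s ≤ r * t
  *-mono-≤ {p} {s} {r} {t} 0≤p 0≤s p≤r s≤t =
    ≤-trans (*-monoʳ-≤ s 0≤s p≤r) (*-monoˡ-≤ r (≤-trans 0≤p p≤r) s≤t)

  *-mono-< : 0ℚ < p → 0ℚ < s → p < r → s < t → p * s < r * t
  *-mono-< {p} {s} {r} {t} 0<p 0<s p<r s<t =
    <-trans (*-monoʳ-< s 0<s p<r) (*-monoˡ-< r (<-trans 0<p p<r) s<t)

  *-cancelˡ-< : ∀ t → 0ℚ < t → t * p < t * r → p < r
  *-cancelˡ-< t 0<t = *-cancelˡ-<-nonNeg t {{nonNegative (<⇒≤ 0<t)}}

  *-cancelˡ-≤ : ∀ t → 0ℚ < t → t * p ≤ t * r → p ≤ r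
  *-cancelˡ-≤ t 0<t = *-cancelˡ-≤-pos t {{positive 0<t}}

  recip : 0ℚ < p → ∃[ h ] 0ℚ < h × p * h ≡ 1ℚ
  recip {p} 0<p =
    let instance _ = positive 0<p
        instance _ = pos⇒nonZero p
    in 1/ p , positive⁻¹ (1/ p) {{1/pos⇒pos p}} , *-inverseʳ p

  *-*-cancel : ∀ r s t → t * s ≡ 1ℚ → r * s * t ≡ r
  *-*-cancel r s t ts≡1 = trans (*-assoc r s t)
    (trans (cong (r *_) (trans (*-comm s t) ts≡1)) (*-identityʳ r))

  divide : 1ℚ < c → ∀ p → 0ℚ < p → ∃[ s ] 0ℚ < s × c * s ≡ p
  divide {c} 1<c p 0<p =
    let (h , 0<h , ch≡1) = recip (<-trans 0<1ℚ 1<c)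
    in h * p , *-pos 0<h 0<p
     , trans (sym (*-assoc c h p)) (trans (cong (_* p) ch≡1) (*-identityˡ p))

  ratio : 0ℚ < p → p < r → ∃[ c ] 1ℚ < c × c * p ≡ r
  ratio {p} {r} 0<p p<r =
    let (h , 0<h , ph≡1) = recip 0<p
    in r * h , subst (_< r * h) ph≡1 (*-monoʳ-< h 0<h p<r) , *-*-cancel r h p ph≡1

  <-scale : 1ℚ < c → 0ℚ < p → p < c * p
  <-scale {c} {p} 1<c 0<p = subst (_< c * p) (*-identityˡ p) (*-monoʳ-< p 0<p 1<c)

  -- Take d = 2c / (1 + c); then d² ≤ c because 4c ≤ (1 + c)².
  sqrt-below : 1ℚ < c → ∃[ d ] 1ℚ < d × d * d ≤ c
  sqrt-below {c} 1<c =
    let 0<c = <-trans 0<1ℚ 1<c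
        0<1+c = subst (_< 1ℚ + c) (+-identityˡ 0ℚ) (+-mono-< 0<1ℚ 0<c)
        (h , 0<h , [1+c]h≡1) = recip 0<1+c
        k  = c - 1ℚ
        0<k = subst (_< k) (+-inverseʳ 1ℚ) (+-monoˡ-< (- 1ℚ) 1<c)
        0<kh = *-pos 0<k 0<h
        0<gap = *-pos 0<c (*-pos 0<kh 0<kh)
        d = (c + c) * h
        d²+gap≡c = trans (expand c h)
          (trans (cong (λ z → c * (z * z)) [1+c]h≡1)
                 (trans (cong (c *_) (*-identityˡ 1ℚ)) (*-identityʳ c)))
    in d
     , subst (_< d) [1+c]h≡1 (*-monoʳ-< h 0<h (+-monoˡ-< c 1<c))
     , subst₂ _≤_ (+-identityʳ (d * d)) d²+gap≡c (+-monoʳ-≤ (d * d) (<⇒≤ 0<gap))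
    where
    open +-*-Solver using (solve; _:+_; _:*_; _:-_; _:=_; con)
    expand : ∀ c h → ((c + c) * h) * ((c + c) * h) + c * (((c - 1ℚ) * h) * ((c - 1ℚ) * h))
                   ≡ c * (((1ℚ + c) * h) * ((1ℚ + c) * h))
    expand = solve 2 (λ c h →
      ((c :+ c) :* h) :* ((c :+ c) :* h) :+ c :* (((c :- con 1ℚ) :* h) :* ((c :- con 1ℚ) :* h))
        := c :* (((con 1ℚ :+ c) :* h) :* ((con 1ℚ :+ c) :* h))) refl

  ^-pos : ∀ k → 0ℚ < p → 0ℚ < p ^ k
  ^-pos zero    0<p = 0<1ℚ
  ^-pos (suc k) 0<p = *-pos 0<p (^-pos k 0<p)

  ^-mono-≤ : ∀ k → 0ℚ < p → p ≤ r → p ^ k ≤ r ^ k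
  ^-mono-≤ zero    0<p p≤r = ≤-refl
  ^-mono-≤ (suc k) 0<p p≤r = *-mono-≤ (<⇒≤ 0<p) (<⇒≤ (^-pos k 0<p)) p≤r (^-mono-≤ k 0<p p≤r)

  ^-mono-< : ∀ k .{{_ : ℕ.NonZero k}} → 0ℚ < p → p < r → p ^ k < r ^ k
  ^-mono-< {p} {r} (suc k) 0<p p<r =
    <-≤-trans (*-monoʳ-< (p ^ k) (^-pos k 0<p) p<r)
              (*-monoˡ-≤ r (<⇒≤ (<-trans 0<p p<r)) (^-mono-≤ k 0<p (<⇒≤ p<r)))

  ^-cancel-< : ∀ k → 0ℚ < r → p ^ k < r ^ k → p < r
  ^-cancel-< {r} {p} k 0<r p^k<r^k with p <? r
  ... | yes p<r = p<r
  ... | no  p≮r = contradiction (<-≤-trans p^k<r^k (^-mono-≤ k 0<r (≮⇒≥ p≮r))) (<-irrefl refl)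

  *-^ : ∀ p r k → (p * r) ^ k ≡ p ^ k * r ^ k
  *-^ = ^-distrib-* (CommutativeRing.commutativeSemiring +-*-commutativeRing)

  1^ : ∀ k → 1ℚ ^ k ≡ 1ℚ
  1^ zero    = refl
  1^ (suc k) = trans (*-identityˡ (1ℚ ^ k)) (1^ k)

  lower-bound : s < p → s < r → ∃[ d ] s < d × d ≤ p × d ≤ r
  lower-bound {p = p} {r = r} s<p s<r with ≤-total p r
  ... | inj₁ p≤r = p , s<p , ≤-refl , p≤r
  ... | inj₂ r≤p = r , s<r , r≤p , ≤-refl

  upper-bound : ∀ p r → ∃[ u ] p ≤ u × r ≤ u
  upper-bound p r with ≤-total p r
  ... | inj₁ p≤r = r , p≤r , ≤-refl
  ... | inj₂ r≤p = p , ≤-refl , r≤p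

  root-below : ∀ k → 1ℚ < c → ∃[ d ] 1ℚ < d × d ^ k ≤ c
  root-below {c} zero 1<c = c , 1<c , <⇒≤ 1<c
  root-below (suc k) 1<c =
    let (d₁ , 1<d₁ , d₁²≤c)   = sqrt-below 1<c
        (d₂ , 1<d₂ , d₂^k≤d₁) = root-below k 1<d₁
        (d , 1<d , d≤d₁ , d≤d₂) = lower-bound 1<d₁ 1<d₂
        0<d = <-trans 0<1ℚ 1<d
        d^k≤d₁ = ≤-trans (^-mono-≤ k 0<d d≤d₂) d₂^k≤d₁
    in d , 1<d , ≤-trans (*-mono-≤ {d} {d ^ k} (<⇒≤ 0<d) (<⇒≤ (^-pos k 0<d)) d≤d₁ d^k≤d₁) d₁²≤c

  suc/1 : ∀ n → (+ suc n) /1 ≡ 1ℚ + (+ n) /1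
  suc/1 n = toℚᵘ-injective (begin
    toℚᵘ ((+ suc n) /1)                  ≈⟨ toℚᵘ-fromℚᵘ (mkℚᵘ (+ suc n) 0) ⟩
    mkℚᵘ (+ suc n) 0                     ≈⟨ *≡* (cong (λ i → (+ 1 ℤ.+ i) ℤ.* + 1) (sym (ℤ.*-identityʳ (+ n)))) ⟩
    mkℚᵘ (+ 1) 0 ℚᵘ.+ mkℚᵘ (+ n) 0       ≈⟨ ℚᵘ.+-congʳ (mkℚᵘ (+ 1) 0) (toℚᵘ-fromℚᵘ (mkℚᵘ (+ n) 0)) ⟨
    toℚᵘ 1ℚ ℚᵘ.+ toℚᵘ ((+ n) /1)         ≈⟨ toℚᵘ-homo-+ 1ℚ ((+ n) /1) ⟨
    toℚᵘ (1ℚ + (+ n) /1)                 ∎)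
    where open ℚᵘ.≃-Reasoning

  archimedean : ∀ r → ∃[ n ] r ≤ (+ n) /1
  archimedean r@(mkℚ i d _) =
    ℤ.∣ i ∣ , subst (r ≤_) (sym (normalize-coprime n⊥1)) (*≤* (i*1≤ i))
    where
    n⊥1 : Coprimality.Coprime ℤ.∣ i ∣ 1
    n⊥1 = Coprimality.sym (Coprimality.1-coprimeTo ℤ.∣ i ∣)
    i*1≤ : ∀ i → i ℤ.* + 1 ℤ.≤ + ℤ.∣ i ∣ ℤ.* + suc d
    i*1≤ (+ n)      = ℤ.*-monoˡ-≤-nonNeg (+ n) (ℤ.+≤+ (ℕ.s≤s ℕ.z≤n))
    i*1≤ (-[1+ n ]) = ℤ.-≤+

  n/1≥0 : ∀ n → 0ℚ ≤ (+ n) /1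
  n/1≥0 zero    = ≤-refl
  n/1≥0 (suc n) = <⇒≤ (i/1>0 {+ suc n} (ℤ.+<+ (ℕ.s≤s ℕ.z≤n)))

  bernoulli : ∀ n → 0ℚ < p → 1ℚ + (+ n) /1 * p ≤ (1ℚ + p) ^ n
  bernoulli {p} zero    0<p = ≤-reflexive (trans (cong (λ z → 1ℚ + z) (*-zeroˡ p)) (+-identityʳ 1ℚ))
  bernoulli {p} (suc n) 0<p =
    let m = (+ n) /1
        0≤1+p = subst (_≤ 1ℚ + p) (+-identityʳ 0ℚ) (+-mono-≤ (<⇒≤ 0<1ℚ) (<⇒≤ 0<p))
        0≤mpp = subst (_≤ m * (p * p)) (*-zeroˡ (p * p))
                  (*-monoʳ-≤ (p * p) (<⇒≤ (*-pos 0<p 0<p)) (n/1≥0 n))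
        step = subst₂ _≤_ (+-identityʳ (1ℚ + (1ℚ + m) * p)) (expand m p)
                 (+-monoʳ-≤ (1ℚ + (1ℚ + m) * p) 0≤mpp)
    in ≤-trans (≤-reflexive (cong (λ z → 1ℚ + z * p) (suc/1 n)))
         (≤-trans step (*-monoˡ-≤ (1ℚ + p) 0≤1+p (bernoulli n 0<p)))
    where
    open +-*-Solver using (solve; _:+_; _:*_; _:=_; con)
    expand : ∀ m p → (1ℚ + (1ℚ + m) * p) + m * (p * p) ≡ (1ℚ + p) * (1ℚ + m * p)
    expand = solve 2 (λ m p → (con 1ℚ :+ (con 1ℚ :+ m) :* p) :+ m :* (p :* p)
                           := (con 1ℚ :+ p) :* (con 1ℚ :+ m :* p)) refl

  powers-unbounded : 1ℚ < c → ∀ r → ∃[ n ] r ≤ c ^ n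
  powers-unbounded {c} 1<c r =
    let k = c - 1ℚ
        0<k = subst (_< k) (+-inverseʳ 1ℚ) (+-monoˡ-< (- 1ℚ) 1<c)
        (h , _ , kh≡1) = recip 0<k
        (n , rh≤n) = archimedean (r * h)
        r≤nk = subst (_≤ (+ n) /1 * k) (*-*-cancel r h k kh≡1) (*-monoʳ-≤ k (<⇒≤ 0<k) rh≤n)
        r≤1+nk = subst (_≤ 1ℚ + (+ n) /1 * k) (+-identityˡ r) (+-mono-≤ (<⇒≤ 0<1ℚ) r≤nk)
    in n , ≤-trans r≤1+nk (≤-trans (bernoulli n 0<k) (≤-reflexive (cong (_^ n) (1+k≡c c))))
    where
    open +-*-Solver using (solve; _:+_; _:-_; _:=_; con)
    1+k≡c : ∀ c → 1ℚ + (c - 1ℚ) ≡ c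
    1+k≡c = solve 1 (λ c → con 1ℚ :+ (c :- con 1ℚ) := c) refl

-- A positive real is a two-sided Dedekind cut in the positive rationals: L
-- and U are the positive rationals below and above it.  Locatedness is in
-- multiplicative form, asking for elements of L and U with any prescribed
-- ratio c > 1; it also makes L and U inhabited.
record ℝ⁺ : Set₁ where
  field
    L U      : ℚ → Set
    L-pos    : L p → 0ℚ < p
    L-down   : 0ℚ < p → p ≤ r → L r → L p
    U-up     : p ≤ r → U p → U r
    L-open   : L p → ∃[ r ] p < r × L r
    U-open   : U r → ∃[ p ] p < r × U p
    disjoint : L p → U r → p < r
    located  : 1ℚ < c → ∃[ l ] L l × U (c * l)

  U-pos : U r → 0ℚ < r
  U-pos r∈U with located 1<2
  ... | l , l∈L , _ = <-trans (L-pos l∈L) (disjoint l∈L r∈U)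

  cotrans : 0ℚ < p → p < r → L p ⊎ U r
  cotrans {p} {r} 0<p p<r =
    let (c , 1<c , cp≡r) = ratio 0<p p<r
        (l , l∈L , cl∈U) = located 1<c
        0≤c = <⇒≤ (<-trans 0<1ℚ 1<c)
    in case p ≤? l of λ where
         (yes p≤l) → inj₁ (L-down 0<p p≤l l∈L)
         (no  p≰l) → inj₂ (U-up (subst (c * l ≤_) cp≡r (*-monoˡ-≤ c 0≤c (<⇒≤ (≰⇒> p≰l)))) cl∈U)

open ℝ⁺ public using (L; U)

infix 4 _≤ʳ_

-- Comparison of a real with a rational: as L x has no greatest element, this
-- is inclusion of L x in the rationals below r.
_≤ʳ_ : ℝ⁺ → ℚ → Set
x ≤ʳ r = ∀ {p} → L x p → p ≤ r

ι : (p : ℚ) → 0ℚ < p → ℝ⁺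
ι a 0<a = record
  { L        = λ p → 0ℚ < p × p < a
  ; U        = λ r → a < r
  ; L-pos    = proj₁
  ; L-down   = λ 0<p p≤r r∈L → 0<p , ≤-<-trans p≤r (proj₂ r∈L)
  ; U-up     = λ p≤r a<p → <-≤-trans a<p p≤r
  ; L-open   = λ { (0<p , p<a) → let (m , p<m , m<a) = <-dense p<a
                                 in m , p<m , <-trans 0<p p<m , m<a }
  ; U-open   = λ a<r → let (m , a<m , m<r) = <-dense a<r in m , m<r , a<m
  ; disjoint = λ { (_ , p<a) a<r → <-trans p<a a<r }
  ; located  = loc
  }
  where
  loc : 1ℚ < c → ∃[ l ] (0ℚ < l × l < a) × a < c * l
  loc {c} 1<c =
    let (d , 1<d , d²≤c) = sqrt-below 1<c
        (l , 0<l , dl≡a) = divide 1<d a 0<a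
        a<ddl = subst (a <_) (trans (cong (d *_) (sym dl≡a)) (sym (*-assoc d d l)))
                  (<-scale {d} {a} 1<d 0<a)
    in l , (0<l , subst (l <_) dl≡a (<-scale {d} {l} 1<d 0<l))
     , <-≤-trans a<ddl (*-monoʳ-≤ l (<⇒≤ 0<l) d²≤c)

ιᶻ : (i : ℤ) → + 0 ℤ.< i → ℝ⁺
ιᶻ i 0<i = ι (i /1) (i/1>0 0<i)

infixl 7 _·_ _÷ʳ_
infix  8 _⁻¹ √_
infixr 8 _^ⁿ_ _^ᶻ_ _^ʳ_

_·_ : ℝ⁺ → ℝ⁺ → ℝ⁺
x · y = record
  { L        = λ p → 0ℚ < p × ∃[ s ] ∃[ t ] L x s × L y t × p ≤ s * t
  ; U        = λ r → ∃[ s ] ∃[ t ] U x s × U y t × s * t ≤ r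
  ; L-pos    = proj₁
  ; L-down   = λ { 0<p p≤r (_ , s , t , s∈L , t∈L , r≤st) →
                   0<p , s , t , s∈L , t∈L , ≤-trans p≤r r≤st }
  ; U-up     = λ { p≤r (s , t , s∈U , t∈U , st≤p) → s , t , s∈U , t∈U , ≤-trans st≤p p≤r }
  ; L-open   = λ { (0<p , s , t , s∈L , t∈L , p≤st) →
                   let (s′ , s<s′ , s′∈L) = X.L-open s∈L
                       (t′ , t<t′ , t′∈L) = Y.L-open t∈L
                       p<s′t′ = ≤-<-trans p≤st (*-mono-< (X.L-pos s∈L) (Y.L-pos t∈L) s<s′ t<t′)
                   in s′ * t′ , p<s′t′ , <-trans 0<p p<s′t′ , s′ , t′ , s′∈L , t′∈L , ≤-refl }
  ; U-open   = λ { (s , t , s∈U , t∈U , st≤r) →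
                   let (s′ , s′<s , s′∈U) = X.U-open s∈U
                       (t′ , t′<t , t′∈U) = Y.U-open t∈U
                   in s′ * t′
                    , <-≤-trans (*-mono-< (X.U-pos s′∈U) (Y.U-pos t′∈U) s′<s t′<t) st≤r
                    , s′ , t′ , s′∈U , t′∈U , ≤-refl }
  ; disjoint = λ { (_ , s , t , s∈L , t∈L , p≤st) (s′ , t′ , s′∈U , t′∈U , s′t′≤r) →
                   ≤-<-trans p≤st (<-≤-trans
                     (*-mono-< (X.L-pos s∈L) (Y.L-pos t∈L) (X.disjoint s∈L s′∈U) (Y.disjoint t∈L t′∈U))
                     s′t′≤r) }
  ; located  = loc
  }
  where
  module X = ℝ⁺ x
  module Y = ℝ⁺ y
  swap : ∀ d s t → (d * d) * (s * t) ≡ (d * s) * (d * t)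
  swap = solve 3 (λ d s t → (d :* d) :* (s :* t) := (d :* s) :* (d :* t)) refl
    where open +-*-Solver using (solve; _:*_; _:=_)
  loc : 1ℚ < c → ∃[ l ] (0ℚ < l × ∃[ s ] ∃[ t ] L x s × L y t × l ≤ s * t)
                      × (∃[ s ] ∃[ t ] U x s × U y t × s * t ≤ c * l)
  loc {c} 1<c =
    let (d , 1<d , d²≤c) = sqrt-below 1<c
        (s , s∈L , ds∈U) = X.located 1<d
        (t , t∈L , dt∈U) = Y.located 1<d
        0<st = *-pos (X.L-pos s∈L) (Y.L-pos t∈L)
    in s * t , (0<st , s , t , s∈L , t∈L , ≤-refl)
     , d * s , d * t , ds∈U , dt∈U
     , subst (_≤ c * (s * t)) (swap d s t) (*-monoʳ-≤ (s * t) (<⇒≤ 0<st) d²≤c)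

-- p < x⁻¹ iff p ≤ s⁻¹ for some s > x, and symmetrically for U.
_⁻¹ : ℝ⁺ → ℝ⁺
x ⁻¹ = record
  { L        = λ p → 0ℚ < p × ∃[ s ] U x s × p * s ≤ 1ℚ
  ; U        = λ r → ∃[ s ] L x s × 1ℚ ≤ r * s
  ; L-pos    = proj₁
  ; L-down   = λ { 0<p p≤r (_ , s , s∈U , rs≤1) →
                   0<p , s , s∈U , ≤-trans (*-monoʳ-≤ s (<⇒≤ (X.U-pos s∈U)) p≤r) rs≤1 }
  ; U-up     = λ { p≤r (s , s∈L , 1≤ps) →
                   s , s∈L , ≤-trans 1≤ps (*-monoʳ-≤ s (<⇒≤ (X.L-pos s∈L)) p≤r) }
  ; L-open   = λ { {p} (0<p , s , s∈U , ps≤1) →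
                   let (s′ , s′<s , s′∈U) = X.U-open s∈U
                       (h , 0<h , s′h≡1) = recip (X.U-pos s′∈U)
                       s′p<s′h = subst₂ _<_ (*-comm p s′) (sym s′h≡1)
                                   (<-≤-trans (*-monoˡ-< p 0<p s′<s) ps≤1)
                   in h , *-cancelˡ-< s′ (X.U-pos s′∈U) s′p<s′h
                    , 0<h , s′ , s′∈U , ≤-reflexive (trans (*-comm h s′) s′h≡1) }
  ; U-open   = λ { {r} (s , s∈L , 1≤rs) →
                   let (s′ , s<s′ , s′∈L) = X.L-open s∈L
                       (h , 0<h , s′h≡1) = recip (X.L-pos s′∈L)
                       s′h<s′r = subst₂ _<_ (sym s′h≡1) (*-comm r s′)
                                   (≤-<-trans 1≤rs (*-monoˡ-< r (r-pos s∈L 1≤rs) s<s′))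
                   in h , *-cancelˡ-< s′ (X.L-pos s′∈L) s′h<s′r
                    , s′ , s′∈L , ≤-reflexive (sym (trans (*-comm h s′) s′h≡1)) }
  ; disjoint = λ { {p} {r} (0<p , s , s∈U , ps≤1) (s′ , s′∈L , 1≤rs′) →
                   *-cancelˡ-< s′ (X.L-pos s′∈L)
                     (subst₂ _<_ (*-comm p s′) (*-comm r s′)
                       (<-≤-trans (*-monoˡ-< p 0<p (X.disjoint s′∈L s∈U)) (≤-trans ps≤1 1≤rs′))) }
  ; located  = loc
  }
  where
  module X = ℝ⁺ x
  r-pos : L x s → 1ℚ ≤ r * s → 0ℚ < r
  r-pos {s} {r} s∈L 1≤rs = *-cancelˡ-< s (X.L-pos s∈L)
    (subst₂ _<_ (sym (*-zeroʳ s)) (*-comm r s) (<-≤-trans 0<1ℚ 1≤rs))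
  loc : 1ℚ < c → ∃[ l ] (0ℚ < l × ∃[ s ] U x s × l * s ≤ 1ℚ)
                      × (∃[ s ] L x s × 1ℚ ≤ c * l * s)
  loc {c} 1<c =
    let (l , l∈L , cl∈U) = X.located 1<c
        (h , 0<h , clh≡1) = recip (X.U-pos cl∈U)
    in h , (0<h , c * l , cl∈U , ≤-reflexive (trans (*-comm h (c * l)) clh≡1))
     , l , l∈L , ≤-reflexive (sym (trans (swap c h l) clh≡1))
    where
    open +-*-Solver using (solve; _:*_; _:=_)
    swap : ∀ c h l → c * h * l ≡ c * l * h
    swap = solve 3 (λ c h l → c :* h :* l := c :* l :* h) refl

_÷ʳ_ : ℝ⁺ → ℝ⁺ → ℝ⁺
x ÷ʳ y = x · y ⁻¹

_^ⁿ_ : ℝ⁺ → ℕ → ℝ⁺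
x ^ⁿ zero  = ι 1ℚ 0<1ℚ
x ^ⁿ suc n = x · x ^ⁿ n

_^ᶻ_ : ℝ⁺ → ℤ → ℝ⁺
x ^ᶻ (+ n)      = x ^ⁿ n
x ^ᶻ (-[1+ n ]) = (x ^ⁿ suc n) ⁻¹

-- On positive rationals, p < ᵏ√x iff pᵏ < x.
root : (k : ℕ) .{{_ : ℕ.NonZero k}} → ℝ⁺ → ℝ⁺
root k x = record
  { L        = λ p → 0ℚ < p × L x (p ^ k)
  ; U        = λ r → 0ℚ < r × U x (r ^ k)
  ; L-pos    = proj₁
  ; L-down   = λ { 0<p p≤r (_ , r^k∈L) →
                   0<p , X.L-down (^-pos k 0<p) (^-mono-≤ k 0<p p≤r) r^k∈L }
  ; U-up     = λ { p≤r (0<p , p^k∈U) →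
                   <-≤-trans 0<p p≤r , X.U-up (^-mono-≤ k 0<p p≤r) p^k∈U }
  ; L-open   = L-open
  ; U-open   = U-open
  ; disjoint = λ { (0<p , p^k∈L) (0<r , r^k∈U) → ^-cancel-< k 0<r (X.disjoint p^k∈L r^k∈U) }
  ; located  = loc
  }
  where
  module X = ℝ⁺ x

  L-open : 0ℚ < p × L x (p ^ k) → ∃[ r ] p < r × 0ℚ < r × L x (r ^ k)
  L-open {p} (0<p , p^k∈L) =
    let (t , p^k<t , t∈L) = X.L-open p^k∈L
        (c , 1<c , cp^k≡t) = ratio (^-pos k 0<p) p^k<t
        (d , 1<d , d^k≤c) = root-below k 1<c
        0<dp = *-pos (<-trans 0<1ℚ 1<d) 0<p
        [dp]^k≤t = subst₂ _≤_ (sym (*-^ d p k)) cp^k≡t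
                     (*-monoʳ-≤ (p ^ k) (<⇒≤ (^-pos k 0<p)) d^k≤c)
    in d * p , <-scale {d} {p} 1<d 0<p , 0<dp , X.L-down (^-pos k 0<dp) [dp]^k≤t t∈L

  U-open : 0ℚ < r × U x (r ^ k) → ∃[ p ] p < r × 0ℚ < p × U x (p ^ k)
  U-open {r} (0<r , r^k∈U) =
    let (t , t<r^k , t∈U) = X.U-open r^k∈U
        (c , 1<c , ct≡r^k) = ratio (X.U-pos t∈U) t<r^k
        (d , 1<d , d^k≤c) = root-below k 1<c
        (p , 0<p , dp≡r) = divide 1<d r 0<r
        ct≡d^kp^k = trans ct≡r^k (trans (cong (_^ k) (sym dp≡r)) (*-^ d p k))
        t≤p^k = *-cancelˡ-≤ (d ^ k) (^-pos k (<-trans 0<1ℚ 1<d))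
                  (subst (d ^ k * t ≤_) ct≡d^kp^k (*-monoʳ-≤ t (<⇒≤ (X.U-pos t∈U)) d^k≤c))
    in p , subst (p <_) dp≡r (<-scale {d} {p} 1<d 0<p) , 0<p , X.U-up t≤p^k t∈U

  ^-≤ : ∀ k .{{_ : ℕ.NonZero k}} → 0ℚ < s → s ≤ t → s ≤ 1ℚ → s ^ k ≤ t
  ^-≤ {s} {t} (suc k) 0<s s≤t s≤1 = subst (s ^ suc k ≤_) (*-identityʳ t)
    (*-mono-≤ {s} {s ^ k} (<⇒≤ 0<s) (<⇒≤ (^-pos k 0<s)) s≤t
      (subst (s ^ k ≤_) (1^ k) (^-mono-≤ k 0<s s≤1)))

  ≤-^ : ∀ k .{{_ : ℕ.NonZero k}} → 0ℚ < s → s ≤ t → 1ℚ ≤ t → s ≤ t ^ k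
  ≤-^ {s} {t} (suc k) 0<s s≤t 1≤t = subst (_≤ t ^ suc k) (*-identityʳ s)
    (*-mono-≤ {s} {1ℚ} {t} {t ^ k} (<⇒≤ 0<s) (<⇒≤ 0<1ℚ) s≤t
      (subst (_≤ t ^ k) (1^ k) (^-mono-≤ k 0<1ℚ 1≤t)))

  start : ∃[ l ] 0ℚ < l × L x (l ^ k)
  start =
    let (l , l∈L , _) = X.located 1<2
        (m , 0<m , m≤l , m≤1) = lower-bound (X.L-pos l∈L) 0<1ℚ
    in m , 0<m , X.L-down (^-pos k 0<m) (^-≤ k 0<m m≤l m≤1) l∈L

  finish : ∃[ u ] 0ℚ < u × U x (u ^ k)
  finish =
    let (l , _ , u∈U) = X.located 1<2
        (m , u≤m , 1≤m) = upper-bound (2ℚ * l) 1ℚ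
    in m , <-≤-trans 0<1ℚ 1≤m , X.U-up (≤-^ k (X.U-pos u∈U) u≤m 1≤m) u∈U

  module _ {c e : ℚ} (1<c : 1ℚ < c) (1<e : 1ℚ < e) (e²≤c : e * e ≤ c) where

    0<e = <-trans 0<1ℚ 1<e

    rotate : ∀ e f l → e * f * l ≡ f * (e * l)
    rotate = solve 3 (λ e f l → e :* f :* l := f :* (e :* l)) refl
      where open +-*-Solver using (solve; _:*_; _:=_)

    search : ∀ n l → 0ℚ < l → L x (l ^ k) → U x ((e ^ n * l) ^ k) →
             ∃[ l ] (0ℚ < l × L x (l ^ k)) × (0ℚ < c * l × U x ((c * l) ^ k))
    search zero l 0<l l∈L u∈U =
      contradiction (X.disjoint l∈L (subst (λ z → U x (z ^ k)) (*-identityˡ l) u∈U)) (<-irrefl refl)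
    search (suc n) l 0<l l∈L u∈U =
      let 0<el  = *-pos 0<e 0<l
          eel≤cl = subst (_≤ c * l) (*-assoc e e l) (*-monoʳ-≤ l (<⇒≤ 0<l) e²≤c)
      in case X.cotrans (^-pos k 0<el) (^-mono-< k 0<el (<-scale {e} {e * l} 1<e 0<el)) of λ where
           (inj₁ el∈L) → search n (e * l) 0<el el∈L
             (subst (λ z → U x (z ^ k)) (rotate e (e ^ n) l) u∈U)
           (inj₂ eel∈U) → l , (0<l , l∈L) , *-pos (<-trans 0<1ℚ 1<c) 0<l
             , X.U-up (^-mono-≤ k (*-pos 0<e 0<el) eel≤cl) eel∈U

  loc : 1ℚ < c → ∃[ l ] (0ℚ < l × L x (l ^ k)) × (0ℚ < c * l × U x ((c * l) ^ k))
  loc {c} 1<c =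
    let (e , 1<e , e²≤c) = sqrt-below 1<c
        (l , 0<l , l∈L)  = start
        (u , 0<u , u∈U)  = finish
        (h , 0<h , lh≡1) = recip 0<l
        (n , uh≤e^n)     = powers-unbounded 1<e (u * h)
        u≤e^nl = subst (_≤ e ^ n * l) (*-*-cancel u h l lh≡1) (*-monoʳ-≤ l (<⇒≤ 0<l) uh≤e^n)
    in search 1<c 1<e e²≤c n l 0<l l∈L (X.U-up (^-mono-≤ k 0<u u≤e^nl) u∈U)

√_ : ℝ⁺ → ℝ⁺
√ x = root 2 x

-- x to the power m/k, in lowest terms, is the k-th root of xᵐ.
_^ʳ_ : ℝ⁺ → ℚ → ℝ⁺
x ^ʳ r = root (↧ₙ r) (x ^ᶻ ↥ r)

-- lcm {v₁, …, vₙ}; the term v₀ is excluded.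
lcmUpTo : (ℕ → ℕ) → ℕ → ℕ
lcmUpTo v n = foldr ℕ.lcm 1 (applyUpTo (λ i → v (suc i)) n)

module Bound (q a b : ℤ) (q≥2 : + 2 ℤ.≤ q) (a≥1 : + 1 ℤ.≤ a) (b≥-a : ℤ.- a ℤ.≤ b) where

  private
    pos*pos : ∀ {i j} → + 0 ℤ.< i → + 0 ℤ.< j → + 0 ℤ.< i ℤ.* j
    pos*pos {+ suc m} {+ suc n} _ _ = ℤ.+<+ (ℕ.s≤s ℕ.z≤n)
    pos*pos {+ zero} (ℤ.+<+ ()) _
    pos*pos {+ suc _} {+ zero} _ (ℤ.+<+ ())

    a>0 : + 0 ℤ.< a
    a>0 = ℤ.<-≤-trans (ℤ.+<+ (ℕ.s≤s ℕ.z≤n)) a≥1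

    2a>0 : + 0 ℤ.< + 2 ℤ.* a
    2a>0 = pos*pos {+ 2} (ℤ.+<+ (ℕ.s≤s ℕ.z≤n)) a>0

    q-1>0 : + 0 ℤ.< q ℤ.- + 1
    q-1>0 = ℤ.<-≤-trans (ℤ.+<+ (ℕ.s≤s ℕ.z≤n)) (ℤ.+-monoˡ-≤ (ℤ.- + 1) q≥2)

    2a[q-1]>0 : + 0 ℤ.< + 2 ℤ.* a ℤ.* (q ℤ.- + 1)
    2a[q-1]>0 = pos*pos 2a>0 q-1>0

  q>0 : + 0 ℤ.< q
  q>0 = ℤ.<-≤-trans (ℤ.+<+ (ℕ.s≤s ℕ.z≤n)) q≥2

  a[q-1]>0 : + 0 ℤ.< a ℤ.* (q ℤ.- + 1)
  a[q-1]>0 = pos*pos a>0 q-1>0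

  a[q-1]+1>0 : + 0 ℤ.< a ℤ.* (q ℤ.- + 1) ℤ.+ + 1
  a[q-1]+1>0 = ℤ.+-mono-<-≤ a[q-1]>0 (ℤ.+≤+ ℕ.z≤n)

  aq+b>0 : + 0 ℤ.< a ℤ.* q ℤ.+ b
  aq+b>0 = ℤ.<-≤-trans a[q-1]>0 (ℤ.≤-trans (ℤ.≤-reflexive eq) (ℤ.+-monoʳ-≤ (a ℤ.* q) b≥-a))
    where
    eq : a ℤ.* (q ℤ.- + 1) ≡ a ℤ.* q ℤ.- a
    eq = trans (ℤ.*-distribˡ-+ a q (ℤ.- + 1))
               (cong (λ z → a ℤ.* q ℤ.+ z) (trans (ℤ.*-comm a (ℤ.- + 1)) (ℤ.-1*i≡-i a)))

  b/2a+1/2a[q-1] : ℚ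
  b/2a+1/2a[q-1] = b /1 ÷ (+ 2 ℤ.* a) /1 + 1ℚ ÷ (+ 2 ℤ.* a ℤ.* (q ℤ.- + 1)) /1
    where instance
      _ = >-nonZero (i/1>0 2a>0)
      _ = >-nonZero (i/1>0 2a[q-1]>0)

  A′ : ℚ
  A′ = 0ℚ ⊔ b/2a+1/2a[q-1]

  A′+1>0 : 0ℚ < A′ + 1ℚ
  A′+1>0 = +-mono-≤-< (p≤p⊔q 0ℚ b/2a+1/2a[q-1]) 0<1ℚ

{-# OPTIONS --safe #-}
module Submission where

-- Put r = a(q − 1) and [i] = 1 + q + ⋯ + qⁱ⁻¹, so that v (k + i) = v k + r qᵏ [i].
-- If M is a common multiple of v k, …, v (k + h) with k ≥ 1, then their product
-- divides [h]! M: the differences of the terms are the r qᵏ [i], and all terms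
-- are coprime to r and q.  On the other hand v (k + i) ≥ r qᵏ [i], so the product
-- is at least v 1 (r qᵏ)ʰ [h]!.  Hence lcm ≥ v 1 (r qᵏ)ʰ whenever k + h = n, and
-- with m = n − 1 the choice h = ⌈m/2⌉ already beats the claimed bound, even
-- with the factor A′ + 1 ≥ 1 dropped: use r + 1 ≤ q r and compare exponents
-- of r and q.  Fourth powers remove the square root and the denominator 4, and
-- q to the power 3m clears the negative part of m(m − 3).

module QArithmeticProgression where

  open import Defs using (lcmUpTo)
  open import Data.List using (foldr; applyUpTo)
  open import Data.Nat
  open import Data.Nat.Coprimality using (Coprime; coprime-divisor)
  import Data.Nat.Coprimality as Coprimality
  open import Data.Nat.Divisibility
  open import Data.Nat.LCM using (lcm; m∣lcm[m,n]; n∣lcm[m,n]; gcd*lcm)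
  open import Data.Nat.GCD using (gcd)
  open import Data.Nat.Properties
  open import Data.Nat.Tactic.RingSolver using (solve-∀)
  open import Data.Product using (∃₂; _×_; _,_)
  open import Data.Sum using (_⊎_; inj₁; inj₂; [_,_]′)
  open import Relation.Binary.PropositionalEquality hiding ([_])

  -- Powers, coprimality and divisibility in the naturals.

  ^-distribʳ-* : ∀ m n k → (m * n) ^ k ≡ m ^ k * n ^ k
  ^-distribʳ-* m n zero    = refl
  ^-distribʳ-* m n (suc k) = trans (cong (m * n *_) (^-distribʳ-* m n k))
                                   (interchange m n (m ^ k) (n ^ k))
    where
    interchange : ∀ a b c d → a * b * (c * d) ≡ a * c * (b * d)
    interchange = solve-∀

  coprime-*ˡ : ∀ {m n k} → Coprime m k → Coprime n k → Coprime (m * n) k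
  coprime-*ˡ m⊥k n⊥k (d∣mn , d∣k) =
    n⊥k (coprime-divisor (λ (e∣d , e∣m) → m⊥k (e∣m , ∣-trans e∣d d∣k)) d∣mn , d∣k)

  coprime-*ʳ : ∀ {m n k} → Coprime k m → Coprime k n → Coprime k (m * n)
  coprime-*ʳ k⊥m k⊥n =
    Coprimality.sym (coprime-*ˡ (Coprimality.sym k⊥m) (Coprimality.sym k⊥n))

  coprime-^ʳ : ∀ {m k} n → Coprime k m → Coprime k (m ^ n)
  coprime-^ʳ zero    k⊥m (_ , d∣1) = ∣1⇒≡1 d∣1
  coprime-^ʳ (suc n) k⊥m = coprime-*ʳ k⊥m (coprime-^ʳ n k⊥m)

  ∣foldr-lcm : ∀ (f : ℕ → ℕ) {i n} → i < n → f i ∣ foldr lcm 1 (applyUpTo f n)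
  ∣foldr-lcm f {zero}  {suc n} _         = m∣lcm[m,n] (f 0) _
  ∣foldr-lcm f {suc i} {suc n} (s<s i<n) =
    ∣-trans (∣foldr-lcm (λ i → f (suc i)) i<n) (n∣lcm[m,n] (f 0) _)

  -- As gcd times lcm is the product, a vanishing lcm would force `f 0` or the lcm of the remaining
  -- terms to vanish.
  foldr-lcm≢0 : ∀ (f : ℕ → ℕ) → (∀ i → f i ≢ 0) → ∀ n → foldr lcm 1 (applyUpTo f n) ≢ 0
  foldr-lcm≢0 f f≢0 zero    ()
  foldr-lcm≢0 f f≢0 (suc n) lcm≡0 =
    [ f≢0 0 , foldr-lcm≢0 (λ i → f (suc i)) (λ i → f≢0 (suc i)) n ]′
      (m*n≡0⇒m≡0∨n≡0 (f 0) (begin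
        f 0 * l              ≡⟨ gcd*lcm (f 0) l ⟨
        gcd (f 0) l * lcm (f 0) l ≡⟨ cong (gcd (f 0) l *_) lcm≡0 ⟩
        gcd (f 0) l * 0      ≡⟨ *-zeroʳ (gcd (f 0) l) ⟩
        0                    ∎))
    where
    open ≡-Reasoning
    l = foldr lcm 1 (applyUpTo (λ i → f (suc i)) n)

  -- Multiplying the two divisibilities by `w` and by `u` shows that `u * t * w` divides both
  -- `w * x` and `u * x`, hence their difference. The factor `d` is the price for not knowing that
  -- `u` and `w` are coprime.
  *-∣-difference : ∀ {u w d t x} → u * t ∣ x → w * t ∣ x → w ≡ u + d → u * t * w ∣ d * x
  *-∣-difference {u} {w} {d} {t} {x} ut∣x wt∣x w≡u+d = ∣m+n∣m⇒∣n
    (subst₂ _∣_ (*-comm w (u * t)) (trans (cong (_* x) w≡u+d) (*-distribʳ-+ x u d))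
      (*-monoʳ-∣ w ut∣x))
    (subst (_∣ u * x) (rotate u w t) (*-monoʳ-∣ u wt∣x))
    where
    rotate : ∀ u w t → u * (w * t) ≡ u * t * w
    rotate = solve-∀

  -- The disjunction records the parity of `m`, with `h` the larger half when `m` is odd.
  balanced-halves : ∀ m → ∃₂ λ j h → m ≡ j + h × (h ≡ j ⊎ h ≡ suc j)
  balanced-halves zero = 0 , 0 , refl , inj₁ refl
  balanced-halves (suc m) with balanced-halves m
  ... | j , h , refl , inj₁ refl = j , suc j , sym (+-suc j j) , inj₂ refl
  ... | j , h , refl , inj₂ refl = suc j , suc j , refl , inj₁ refl

  -- Products of consecutive terms of the sequence, given by its recurrence.

  module _ (q r : ℕ) (v : ℕ → ℕ) (v-suc : ∀ n → v (suc n) ≡ v n + r * q ^ n) where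

    [_] : ℕ → ℕ
    [ zero  ] = 0
    [ suc i ] = [ i ] + q ^ i

    -- The q-factorial, the product of the q-integers `[ 1 ]` to `[ i ]`.
    [_]! : ℕ → ℕ
    [ zero  ]! = 1
    [ suc i ]! = [ suc i ] * [ i ]!

    v-+ : ∀ k i → v (k + i) ≡ v k + r * q ^ k * [ i ]
    v-+ k zero = begin
      v (k + 0)               ≡⟨ cong v (+-identityʳ k) ⟩
      v k                     ≡⟨ +-identityʳ (v k) ⟨
      v k + 0                 ≡⟨ cong (v k +_) (*-zeroʳ (r * q ^ k)) ⟨
      v k + r * q ^ k * 0     ∎
      where open ≡-Reasoning
    v-+ k (suc i) = begin
      v (k + suc i)                             ≡⟨ cong v (+-suc k i) ⟩
      v (suc (k + i))                           ≡⟨ v-suc (k + i) ⟩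
      v (k + i) + r * q ^ (k + i)               ≡⟨ cong₂ (λ x y → x + r * y) (v-+ k i) (^-distribˡ-+-* q k i) ⟩
      v k + r * q ^ k * [ i ] + r * (q ^ k * q ^ i) ≡⟨ collect (v k) r (q ^ k) [ i ] (q ^ i) ⟩
      v k + r * q ^ k * ([ i ] + q ^ i)         ∎
      where
      open ≡-Reasoning
      collect : ∀ a r x y z → a + r * x * y + r * (x * z) ≡ a + r * x * (y + z)
      collect = solve-∀

    ∏ : ℕ → ℕ → ℕ
    ∏ k zero    = 1
    ∏ k (suc l) = ∏ k l * v (k + l)

    ∏-sucˡ : ∀ k l → ∏ k (suc l) ≡ v k * ∏ (suc k) l
    ∏-sucˡ k zero    = trans (*-identityˡ (v (k + 0)))
      (trans (cong v (+-identityʳ k)) (sym (*-identityʳ (v k))))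
    ∏-sucˡ k (suc l) = trans (cong₂ (λ x y → x * v y) (∏-sucˡ k l) (+-suc k l))
                             (*-assoc (v k) (∏ (suc k) l) (v (suc k + l)))

    v≤v-+ : ∀ k i → v k ≤ v (k + i)
    v≤v-+ k i = subst (v k ≤_) (sym (v-+ k i)) (m≤m+n (v k) _)

    -- Each factor after the first is `v k + c * [ i ]` with `c = r * q ^ k`, and is bounded below
    -- by its second summand; only the first factor `v k` is kept whole.
    ∏-lower : ∀ k h → v k * (r * q ^ k) ^ h * [ h ]! ≤ ∏ k (suc h)
    ∏-lower k zero = ≤-reflexive (begin
      v k * 1 * 1     ≡⟨ *-identityʳ (v k * 1) ⟩
      v k * 1         ≡⟨ ∏-sucˡ k 0 ⟨
      ∏ k 1           ∎)
      where open ≡-Reasoning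
    ∏-lower k (suc h) = begin
      v k * (c * c ^ h) * ([ suc h ] * [ h ]!)   ≡⟨ regroup (v k) c (c ^ h) [ suc h ] [ h ]! ⟩
      v k * c ^ h * [ h ]! * (c * [ suc h ])     ≤⟨ *-mono-≤ (∏-lower k h) (m≤n+m (c * [ suc h ]) (v k)) ⟩
      ∏ k (suc h) * (v k + c * [ suc h ])        ≡⟨ cong (∏ k (suc h) *_) (v-+ k (suc h)) ⟨
      ∏ k (suc h) * v (k + suc h)                ∎
      where
      open ≤-Reasoning
      c = r * q ^ k
      regroup : ∀ a c x y z → a * (c * x) * (y * z) ≡ a * x * z * (c * y)
      regroup = solve-∀

    module _ (v⊥r : ∀ i → Coprime (v (suc i)) r) (v⊥q : ∀ i → Coprime (v (suc i)) q) where

      -- This allows the factor `r * q ^ j` of a difference of terms to be cancelled from a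
      -- divisibility. The product starts at `suc i` because `v 0` may share a factor with `q`.
      ∏⊥rq^ : ∀ i j l → Coprime (∏ (suc i) l) (r * q ^ j)
      ∏⊥rq^ i j zero    (d∣1 , _) = ∣1⇒≡1 d∣1
      ∏⊥rq^ i j (suc l) =
        coprime-*ˡ (∏⊥rq^ i j l) (coprime-*ʳ (v⊥r (i + l)) (coprime-^ʳ j (v⊥q (i + l))))

      -- With T the product of the inner terms, the induction hypotheses for
      -- the first l + 1 and the last l + 1 terms combine to a divisor of
      -- r qᵏ [l + 1] · [l]! M, as r qᵏ [l + 1] is the last term minus the first.
      ∏∣[]!*multiple : ∀ i l M → (∀ j → j ≤ l → v (suc i + j) ∣ M) →
                       ∏ (suc i) (suc l) ∣ [ l ]! * M
      ∏∣[]!*multiple i zero M v∣M =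
        subst₂ _∣_ (sym (*-identityˡ _)) (sym (*-identityˡ M)) (v∣M 0 z≤n)
      ∏∣[]!*multiple i (suc l) M v∣M =
        subst (∏ k (2 + l) ∣_) (sym (*-assoc [ suc l ] [ l ]! M))
          (coprime-divisor (∏⊥rq^ i k (2 + l))
            (subst₂ _∣_ (cong (_* w) (sym (∏-sucˡ k l))) (*-assoc (r * q ^ k) [ suc l ] ([ l ]! * M))
              (*-∣-difference {v k} {w}
                (subst (_∣ [ l ]! * M) (∏-sucˡ k l)
                  (∏∣[]!*multiple i l M (λ j j≤l → v∣M j (m≤n⇒m≤1+n j≤l))))
                (subst (_∣ [ l ]! * M) (trans (*-comm T (v (suc k + l))) (cong (λ z → v z * T) (sym (+-suc k l))))
                  (∏∣[]!*multiple (suc i) l M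
                    (λ j j≤l → subst (λ z → v z ∣ M) (+-suc k j) (v∣M (suc j) (s≤s j≤l)))))
                (v-+ k (suc l)))))
        where
        k = suc i
        T = ∏ (suc k) l
        w = v (k + suc l)

      -- The lower bound for the lcm, and its fourth power.

      module _ (2≤q : 2 ≤ q) (1≤r : 1 ≤ r) where

        private instance
          q≢0 : NonZero q
          q≢0 = >-nonZero (<-trans z<s 2≤q)
          r≢0 : NonZero r
          r≢0 = >-nonZero 1≤r

        lcm≢0 : ∀ n → NonZero (lcmUpTo v n)
        lcm≢0 n = ≢-nonZero (foldr-lcm≢0 (λ i → v (suc i)) v-suc≢0 n)
          where
          v-suc≢0 : ∀ i → v (suc i) ≢ 0
          v-suc≢0 i v≡0 = <⇒≢ (*-mono-≤ 1≤r (m^n>0 q i))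
            (sym (m+n≡0⇒n≡0 (v i) (trans (sym (v-suc i)) v≡0)))

        []!>0 : ∀ i → 0 < [ i ]!
        []!>0 zero    = z<s
        []!>0 (suc i) = *-mono-≤ (≤-trans (m^n>0 q i) (m≤n+m (q ^ i) [ i ])) ([]!>0 i)

        -- The terms from `v (suc j)` to `v (suc j + h)` are the last `h + 1` of those in the lcm.
        -- Comparing the two estimates of their product cancels `[ h ]!`, and monotonicity replaces
        -- the leading `v (suc j)` by `v 1`.
        lcm-lower : ∀ j h → v 1 * (r * q ^ suc j) ^ h ≤ lcmUpTo v (suc (j + h))
        lcm-lower j h = *-cancelʳ-≤ _ _ [ h ]! (begin
          v 1 * c ^ h * [ h ]!      ≤⟨ *-monoˡ-≤ [ h ]! (*-monoˡ-≤ (c ^ h) (v≤v-+ 1 j)) ⟩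
          v (suc j) * c ^ h * [ h ]! ≤⟨ ∏-lower (suc j) h ⟩
          ∏ (suc j) (suc h)         ≤⟨ ∣⇒≤ (∏∣[]!*multiple j h M (λ i i≤h →
                                         ∣foldr-lcm (λ i → v (suc i)) (s≤s (+-monoʳ-≤ j i≤h)))) ⟩
          [ h ]! * M                ≡⟨ *-comm [ h ]! M ⟩
          M * [ h ]!                ∎)
          where
          open ≤-Reasoning
          c = r * q ^ suc j
          M = lcmUpTo v (suc (j + h))
          instance
            _ = >-nonZero ([]!>0 h)
            _ = lcm≢0 (suc (j + h))
            _ = m*n≢0 [ h ]! M

        power-comparison : ∀ j h → h ≡ j ⊎ h ≡ suc j → let m = j + h in
          suc r ^ (m * 4) * q ^ (m * m) ≤ (r * q ^ suc j) ^ (h * 4) * r ^ (m * 2) * q ^ (3 * m)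
        power-comparison j h h≈j = begin
          suc r ^ (m * 4) * q ^ (m * m)       ≤⟨ *-monoˡ-≤ (q ^ (m * m)) (^-monoˡ-≤ (m * 4) 1+r≤r*q) ⟩
          (r * q) ^ (m * 4) * q ^ (m * m)     ≡⟨ cong (_* q ^ (m * m)) (^-distribʳ-* r q (m * 4)) ⟩
          r ^ (m * 4) * q ^ (m * 4) * q ^ (m * m)   ≡⟨ *-assoc (r ^ (m * 4)) _ _ ⟩
          r ^ (m * 4) * (q ^ (m * 4) * q ^ (m * m)) ≡⟨ cong (r ^ (m * 4) *_) (^-distribˡ-+-* q (m * 4) (m * m)) ⟨
          r ^ (m * 4) * q ^ (m * 4 + m * m)
            ≤⟨ *-mono-≤ (^-monoʳ-≤ r (r-exponent h≈j)) (^-monoʳ-≤ q (q-exponent h≈j)) ⟩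
          r ^ (h * 4 + m * 2) * q ^ (suc j * (h * 4) + 3 * m)
            ≡⟨ cong₂ _*_ (^-distribˡ-+-* r (h * 4) (m * 2)) (^-distribˡ-+-* q (suc j * (h * 4)) (3 * m)) ⟩
          r ^ (h * 4) * r ^ (m * 2) * (q ^ (suc j * (h * 4)) * q ^ (3 * m))
            ≡⟨ cong (λ z → r ^ (h * 4) * r ^ (m * 2) * (z * q ^ (3 * m))) (^-*-assoc q (suc j) (h * 4)) ⟨
          r ^ (h * 4) * r ^ (m * 2) * ((q ^ suc j) ^ (h * 4) * q ^ (3 * m))
            ≡⟨ regroup (r ^ (h * 4)) (r ^ (m * 2)) ((q ^ suc j) ^ (h * 4)) (q ^ (3 * m)) ⟩
          r ^ (h * 4) * (q ^ suc j) ^ (h * 4) * r ^ (m * 2) * q ^ (3 * m)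
            ≡⟨ cong (λ z → z * r ^ (m * 2) * q ^ (3 * m)) (^-distribʳ-* r (q ^ suc j) (h * 4)) ⟨
          (r * q ^ suc j) ^ (h * 4) * r ^ (m * 2) * q ^ (3 * m) ∎
          where
          open ≤-Reasoning
          m = j + h
          regroup : ∀ a b c d → a * b * (c * d) ≡ a * c * b * d
          regroup = solve-∀
          1+r≤r*q : suc r ≤ r * q
          1+r≤r*q = begin
            1 + r     ≤⟨ +-monoˡ-≤ r 1≤r ⟩
            r + r     ≡⟨ cong (r +_) (+-identityʳ r) ⟨
            2 * r     ≡⟨ *-comm 2 r ⟩
            r * 2     ≤⟨ *-monoʳ-≤ r 2≤q ⟩
            r * q     ∎
          r-exponent : h ≡ j ⊎ h ≡ suc j → m * 4 ≤ h * 4 + m * 2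
          r-exponent (inj₁ refl) = ≤-reflexive (eq j)
            where
            eq : ∀ j → (j + j) * 4 ≡ j * 4 + (j + j) * 2
            eq = solve-∀
          -- Rounding `h` up matters here: for odd `m` the smaller half would leave the right-hand
          -- exponent short by 2.
          r-exponent (inj₂ refl) = m+n≤o⇒m≤o _ (≤-reflexive (eq j))
            where
            eq : ∀ j → (j + suc j) * 4 + 2 ≡ suc j * 4 + (j + suc j) * 2
            eq = solve-∀
          q-exponent : h ≡ j ⊎ h ≡ suc j → m * 4 + m * m ≤ suc j * (h * 4) + 3 * m
          -- The slack is 2j when `h` is j, and 2j + 2 when `h` is j + 1.
          q-exponent (inj₁ refl) = m+n≤o⇒m≤o _ (≤-reflexive (eq j))
            where
            eq : ∀ j → (j + j) * 4 + (j + j) * (j + j) + (j + j) ≡ suc j * (j * 4) + 3 * (j + j)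
            eq = solve-∀
          q-exponent (inj₂ refl) = m+n≤o⇒m≤o _ (≤-reflexive (eq j))
            where
            eq : ∀ j → (j + suc j) * 4 + (j + suc j) * (j + suc j) + (2 + 2 * j)
                     ≡ suc j * (suc j * 4) + 3 * (j + suc j)
            eq = solve-∀

        -- This is the fourth power of the bound for n = m + 1 with A′ replaced by 0 and
        -- denominators cleared: `(r ^ m) ^ 2` stands for the fourth power of the m-th power of √r,
        -- and `m * m` minus `3 * m` is (n - 1)(n - 4).
        lcm-lower⁴ : ∀ m → v 1 ^ 4 * (suc r ^ m) ^ 4 * q ^ (m * m)
                         ≤ lcmUpTo v (suc m) ^ 4 * (r ^ m) ^ 2 * q ^ (3 * m)
        lcm-lower⁴ m with balanced-halves m
        ... | j , h , refl , h≈j = begin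
          v 1 ^ 4 * (suc r ^ m) ^ 4 * Q  ≡⟨ cong (λ z → v 1 ^ 4 * z * Q) (^-*-assoc (suc r) m 4) ⟩
          v 1 ^ 4 * suc r ^ (m * 4) * Q  ≡⟨ *-assoc (v 1 ^ 4) _ _ ⟩
          v 1 ^ 4 * (suc r ^ (m * 4) * Q) ≤⟨ *-monoʳ-≤ (v 1 ^ 4) (power-comparison j h h≈j) ⟩
          v 1 ^ 4 * (c ^ (h * 4) * r ^ (m * 2) * Q′)
            ≡⟨ cong₂ (λ x y → v 1 ^ 4 * (x * y * Q′)) (^-*-assoc c h 4) (^-*-assoc r m 2) ⟨
          v 1 ^ 4 * ((c ^ h) ^ 4 * (r ^ m) ^ 2 * Q′)
            ≡⟨ regroup (v 1 ^ 4) ((c ^ h) ^ 4) ((r ^ m) ^ 2) Q′ ⟩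
          v 1 ^ 4 * (c ^ h) ^ 4 * (r ^ m) ^ 2 * Q′
            ≡⟨ cong (λ z → z * (r ^ m) ^ 2 * Q′) (^-distribʳ-* (v 1) (c ^ h) 4) ⟨
          (v 1 * c ^ h) ^ 4 * (r ^ m) ^ 2 * Q′
            ≤⟨ *-monoˡ-≤ Q′ (*-monoˡ-≤ ((r ^ m) ^ 2) (^-monoˡ-≤ 4 (lcm-lower j h))) ⟩
          lcmUpTo v (suc m) ^ 4 * (r ^ m) ^ 2 * Q′ ∎
          where
          open ≤-Reasoning
          c = r * q ^ suc j
          Q = q ^ (m * m)
          Q′ = q ^ (3 * m)
          regroup : ∀ a b c d → a * (b * c * d) ≡ a * b * c * d
          regroup = solve-∀

-- Rational inequalities satisfied by elements of the cuts in the bound.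

module CutBounds where

  open import Defs
  open import Algebra.Bundles using (module CommutativeRing)
  open import Algebra.Properties.Semiring.Exp using (^-homo-*; ^-assocʳ)
  open import Data.Integer as ℤ using (ℤ; +_; -[1+_])
  import Data.Integer.Properties as ℤ
  import Data.Integer.Tactic.RingSolver as ℤ-Solver
  open import Data.Nat as ℕ using (ℕ; zero; suc)
  import Data.Nat.Properties as ℕ
  open import Data.Product using (_,_)
  open import Data.Rational
  open import Data.Rational.Properties
  open import Data.Rational.Solver using (module +-*-Solver)
  open import Data.Rational.Unnormalised using (mkℚᵘ)
  import Data.Rational.Unnormalised.Properties as ℚᵘ
  open import Relation.Binary.PropositionalEquality
  open import Relation.Nullary using (yes; no; contradiction)
  open +-*-Solver using (solve; _:+_; _:*_; _:^_; _:=_; con)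

  private
    variable
      c p s t : ℚ

    ℚ-semiring = CommutativeRing.semiring +-*-commutativeRing

  ^-+ : ∀ p m n → p ^ (m ℕ.+ n) ≡ p ^ m * p ^ n
  ^-+ = ^-homo-* ℚ-semiring

  ^-^ : ∀ p m n → (p ^ m) ^ n ≡ p ^ (m ℕ.* n)
  ^-^ = ^-assocʳ ℚ-semiring

  ^-cancel-≤ : ∀ k .{{_ : ℕ.NonZero k}} → 0ℚ < t → p ^ k ≤ t ^ k → p ≤ t
  ^-cancel-≤ {t} {p} k 0<t p^k≤t^k with p ≤? t
  ... | yes p≤t = p≤t
  ... | no  p≰t = contradiction (<-≤-trans (^-mono-< k 0<t (≰⇒> p≰t)) p^k≤t^k) (<-irrefl refl)

  *-cancelʳ-≤ : ∀ r → 0ℚ < r → p * r ≤ t * r → p ≤ t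
  *-cancelʳ-≤ {p} {t} r 0<r pr≤tr =
    *-cancelˡ-≤ r 0<r (subst₂ _≤_ (*-comm p r) (*-comm t r) pr≤tr)

  +-/1 : ∀ m n → (+ (m ℕ.+ n)) /1 ≡ (+ m) /1 + (+ n) /1
  +-/1 zero    n = sym (+-identityˡ ((+ n) /1))
  +-/1 (suc m) n = begin
    (+ suc (m ℕ.+ n)) /1           ≡⟨ suc/1 (m ℕ.+ n) ⟩
    1ℚ + (+ (m ℕ.+ n)) /1          ≡⟨ cong (λ z → 1ℚ + z) (+-/1 m n) ⟩
    1ℚ + ((+ m) /1 + (+ n) /1)     ≡⟨ +-assoc 1ℚ ((+ m) /1) ((+ n) /1) ⟨
    1ℚ + (+ m) /1 + (+ n) /1       ≡⟨ cong (_+ (+ n) /1) (suc/1 m) ⟨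
    (+ suc m) /1 + (+ n) /1        ∎
    where open ≡-Reasoning

  *-/1 : ∀ m n → (+ (m ℕ.* n)) /1 ≡ (+ m) /1 * (+ n) /1
  *-/1 zero    n = sym (*-zeroˡ ((+ n) /1))
  *-/1 (suc m) n = begin
    (+ (n ℕ.+ m ℕ.* n)) /1              ≡⟨ +-/1 n (m ℕ.* n) ⟩
    (+ n) /1 + (+ (m ℕ.* n)) /1         ≡⟨ cong (λ z → (+ n) /1 + z) (*-/1 m n) ⟩
    (+ n) /1 + (+ m) /1 * (+ n) /1      ≡⟨ factor ((+ m) /1) ((+ n) /1) ⟩
    (1ℚ + (+ m) /1) * (+ n) /1          ≡⟨ cong (_* (+ n) /1) (suc/1 m) ⟨
    (+ suc m) /1 * (+ n) /1             ∎
    where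
    open ≡-Reasoning
    factor : ∀ x y → y + x * y ≡ (1ℚ + x) * y
    factor = solve 2 (λ x y → y :+ x :* y := (con 1ℚ :+ x) :* y) refl

  ^-/1 : ∀ m k → (+ (m ℕ.^ k)) /1 ≡ (+ m) /1 ^ k
  ^-/1 m zero    = refl
  ^-/1 m (suc k) = trans (*-/1 m (m ℕ.^ k)) (cong ((+ m) /1 *_) (^-/1 m k))

  /1-mono-≤ : ∀ {m n} → m ℕ.≤ n → (+ m) /1 ≤ (+ n) /1
  /1-mono-≤ {m} {n} m≤n = subst₂ _≤_ (+-identityʳ ((+ m) /1))
    (trans (sym (+-/1 m (n ℕ.∸ m))) (cong (λ k → (+ k) /1) (ℕ.m+[n∸m]≡n m≤n)))
    (+-monoʳ-≤ ((+ m) /1) (n/1≥0 (n ℕ.∸ m)))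

  -- The power `_^ʳ_` reads its exponent in lowest terms, so `i / 4` may lose its denominator 4;
  -- cross-multiplication recovers the original fraction.
  ↥*n≡i*↧ : ∀ i n .{{_ : ℕ.NonZero n}} → ↥ (i / n) ℤ.* + n ≡ i ℤ.* ↧ (i / n)
  ↥*n≡i*↧ i (suc n) = subst₂ (λ x y → x ℤ.* + suc n ≡ i ℤ.* y)
    (↥ᵘ-toℚᵘ (i / suc n)) (↧ᵘ-toℚᵘ (i / suc n)) (ℚᵘ.drop-*≡* (toℚᵘ-fromℚᵘ (mkℚᵘ i n)))

  √-U : ∀ {c} 0<c → U (√ ι c 0<c) s → c ≤ s * s
  √-U {s} 0<c (_ , c<s²) = ≤-trans (<⇒≤ c<s²) (≤-reflexive (cong (s *_) (*-identityʳ s)))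

  -- Below the quotient, `s` is at most `x * y` with `x < u` and `y * w ≤ 1`, where `w` is at least
  -- `e * f` with `e` above √c and `f` above `d`. Since `d ≥ 1`, also `y * e ≤ 1`. Squaring turns
  -- `e` into a bound on `c`, so the root disappears.
  quotient-L : ∀ {u c d} 0<u 0<c 0<d → 1ℚ ≤ d → L (ι u 0<u ÷ʳ (√ ι c 0<c · ι d 0<d)) s →
               s * s * c ≤ u * u
  quotient-L {s} {u} {c} {d} 0<u 0<c 0<d 1≤d
    (0<s , x , y , (0<x , x<u) , (0<y , w , (e , f , e∈U@(0<e , _) , d<f , ef≤w) , yw≤1) , s≤xy) = begin
    s * s * c                  ≤⟨ *-mono-≤ (<⇒≤ (*-pos 0<s 0<s)) (<⇒≤ 0<c)
                                    (*-mono-≤ (<⇒≤ 0<s) (<⇒≤ 0<s) s≤xy s≤xy) (√-U 0<c e∈U) ⟩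
    x * y * (x * y) * (e * e)  ≡⟨ regroup x y e ⟩
    x * x * (y * e * (y * e))  ≤⟨ *-mono-≤ (<⇒≤ (*-pos 0<x 0<x)) (<⇒≤ (*-pos 0<ye 0<ye))
                                    (*-mono-≤ (<⇒≤ 0<x) (<⇒≤ 0<x) (<⇒≤ x<u) (<⇒≤ x<u))
                                    (*-mono-≤ (<⇒≤ 0<ye) (<⇒≤ 0<ye) ye≤1 ye≤1) ⟩
    u * u * (1ℚ * 1ℚ)          ≡⟨ *-identityʳ (u * u) ⟩
    u * u                      ∎
    where
    open ≤-Reasoning
    0<ye = *-pos 0<y 0<e
    e≤w : e ≤ w
    e≤w = ≤-trans (≤-reflexive (sym (*-identityʳ e)))
      (≤-trans (*-monoˡ-≤ e (<⇒≤ 0<e) (≤-trans 1≤d (<⇒≤ d<f))) ef≤w)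
    ye≤1 = ≤-trans (*-monoˡ-≤ y (<⇒≤ 0<y) e≤w) yw≤1
    regroup : ∀ x y e → x * y * (x * y) * (e * e) ≡ x * x * (y * e * (y * e))
    regroup = solve 3 (λ x y e → x :* y :* (x :* y) :* (e :* e) := x :* x :* (y :* e :* (y :* e))) refl

  -- A bound on squares is multiplicative, so it passes from the lower elements of `x` to those of
  -- its powers, one factor at a time.
  ^ⁿ-L : ∀ x {c d} → 0ℚ < c → (∀ {s} → L x s → s * s * c ≤ d) →
         ∀ m → L (x ^ⁿ m) s → s * s * c ^ m ≤ d ^ m
  ^ⁿ-L {s} x 0<c x-L zero    (0<s , s<1) = begin
    s * s * 1ℚ     ≤⟨ *-monoʳ-≤ 1ℚ (<⇒≤ 0<1ℚ) (*-mono-≤ (<⇒≤ 0<s) (<⇒≤ 0<s) (<⇒≤ s<1) (<⇒≤ s<1)) ⟩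
    1ℚ             ∎
    where open ≤-Reasoning
  ^ⁿ-L {s} x {c} {d} 0<c x-L (suc m) (0<s , y , z , y∈L , z∈L , s≤yz) = begin
    s * s * (c * c ^ m)              ≤⟨ *-monoʳ-≤ (c * c ^ m) (<⇒≤ (^-pos (suc m) 0<c))
                                          (*-mono-≤ (<⇒≤ 0<s) (<⇒≤ 0<s) s≤yz s≤yz) ⟩
    y * z * (y * z) * (c * c ^ m)    ≡⟨ regroup y z c (c ^ m) ⟩
    y * y * c * (z * z * c ^ m)      ≤⟨ *-mono-≤ (<⇒≤ (*-pos (*-pos 0<y 0<y) 0<c))
                                          (<⇒≤ (*-pos (*-pos 0<z 0<z) (^-pos m 0<c)))
                                          (x-L y∈L) (^ⁿ-L x 0<c x-L m z∈L) ⟩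
    d * d ^ m                        ∎
    where
    open ≤-Reasoning
    0<y = ℝ⁺.L-pos x y∈L
    0<z = ℝ⁺.L-pos (x ^ⁿ m) z∈L
    regroup : ∀ y z c e → y * z * (y * z) * (c * e) ≡ y * y * c * (z * z * e)
    regroup = solve 4 (λ y z c e → y :* z :* (y :* z) :* (c :* e) := y :* y :* c :* (z :* z :* e)) refl

  -- Powers of a cut that agrees with a positive rational `c`.

  module _ (x : ℝ⁺) {c : ℚ} (0<c : 0ℚ < c) (x≤c : x ≤ʳ c) (c≤x : ∀ {s} → U x s → c ≤ s) where

    ^ⁿ-≤ʳ : ∀ n → x ^ⁿ n ≤ʳ c ^ n
    ^ⁿ-≤ʳ zero    (_ , s<1) = <⇒≤ s<1
    ^ⁿ-≤ʳ (suc n) (_ , y , z , y∈L , z∈L , s≤yz) = ≤-trans s≤yz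
      (*-mono-≤ (<⇒≤ (ℝ⁺.L-pos x y∈L)) (<⇒≤ (ℝ⁺.L-pos (x ^ⁿ n) z∈L)) (x≤c y∈L) (^ⁿ-≤ʳ n z∈L))

    -- Upper elements matter because negative exponents occur, as for n = 2 and n = 3: lower
    -- elements of a reciprocal come from upper elements of the original.
    ^ⁿ-U : ∀ n → U (x ^ⁿ n) s → c ^ n ≤ s
    ^ⁿ-U zero    1<s = <⇒≤ 1<s
    ^ⁿ-U (suc n) (y , z , y∈U , z∈U , yz≤s) = ≤-trans
      (*-mono-≤ (<⇒≤ 0<c) (<⇒≤ (^-pos n 0<c)) (c≤x y∈U) (^ⁿ-U n z∈U)) yz≤s

    -- Morally `s ^ e` is at most `c` to the power `z * e`; adding `k` to that exponent keeps all
    -- powers natural when `z` is negative. The extra power `e` serves the cross-multiplication in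
    -- `^ʳ-L`.
    ^ᶻ-L : ∀ z e {j k} → L (x ^ᶻ z) s → z ℤ.* + e ℤ.+ + k ≡ + j →
            s ^ e * c ^ k ≤ c ^ j
    ^ᶻ-L {s} (+ n) e {j} {k} s∈L ne+k≡j = begin
      s ^ e * c ^ k          ≤⟨ *-monoʳ-≤ (c ^ k) (<⇒≤ (^-pos k 0<c))
                                  (^-mono-≤ e (ℝ⁺.L-pos (x ^ⁿ n) s∈L) (^ⁿ-≤ʳ n s∈L)) ⟩
      (c ^ n) ^ e * c ^ k    ≡⟨ cong (_* c ^ k) (^-^ c n e) ⟩
      c ^ (n ℕ.* e) * c ^ k  ≡⟨ ^-+ c (n ℕ.* e) k ⟨
      c ^ (n ℕ.* e ℕ.+ k)    ≡⟨ cong (c ^_) (ℤ.+-injective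
                                  (trans (cong (ℤ._+ + k) (ℤ.pos-* n e)) ne+k≡j)) ⟩
      c ^ j                  ∎
      where open ≤-Reasoning
    ^ᶻ-L {s} z@(-[1+ n ]) e {j} {k} (0<s , w , w∈U , sw≤1) ze+k≡j = begin
      -- For `z` equal to -(n + 1), the relation gives `k` as `suc n * e + j`, which supplies
      -- exactly the power of `c` that makes `s * c ^ suc n` at most 1.
      s ^ e * c ^ k                          ≡⟨ cong (λ i → s ^ e * c ^ i) k≡ ⟩
      s ^ e * c ^ (suc n ℕ.* e ℕ.+ j)        ≡⟨ cong (s ^ e *_) (^-+ c (suc n ℕ.* e) j) ⟩
      s ^ e * (c ^ (suc n ℕ.* e) * c ^ j)    ≡⟨ *-assoc (s ^ e) (c ^ (suc n ℕ.* e)) (c ^ j) ⟨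
      s ^ e * c ^ (suc n ℕ.* e) * c ^ j      ≡⟨ cong (λ y → s ^ e * y * c ^ j) (^-^ c (suc n) e) ⟨
      s ^ e * (c ^ suc n) ^ e * c ^ j        ≡⟨ cong (_* c ^ j) (*-^ s (c ^ suc n) e) ⟨
      (s * c ^ suc n) ^ e * c ^ j            ≤⟨ *-monoʳ-≤ (c ^ j) (<⇒≤ (^-pos j 0<c))
                                                  (^-mono-≤ e (*-pos 0<s (^-pos (suc n) 0<c)) sc^n≤1) ⟩
      1ℚ ^ e * c ^ j                         ≡⟨ cong (_* c ^ j) (1^ e) ⟩
      1ℚ * c ^ j                             ≡⟨ *-identityˡ (c ^ j) ⟩
      c ^ j                                  ∎
      where
      open ≤-Reasoning
      sc^n≤1 : s * c ^ suc n ≤ 1ℚ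
      sc^n≤1 = ≤-trans (*-monoˡ-≤ s (<⇒≤ 0<s) (^ⁿ-U (suc n) w∈U)) sw≤1
      move : ∀ z e k → k ≡ ℤ.- z ℤ.* e ℤ.+ (z ℤ.* e ℤ.+ k)
      move = ℤ-Solver.solve-∀
      k≡ : k ≡ suc n ℕ.* e ℕ.+ j
      k≡ = ℤ.+-injective (trans (move z (+ e) (+ k))
             (cong₂ ℤ._+_ (sym (ℤ.pos-* (suc n) e)) ze+k≡j))

    -- i + k = j is the exponent relation with the subtraction moved across.
    ^ʳ-L : ∀ i e .{{_ : ℕ.NonZero e}} {j k} → L (x ^ʳ (i / e)) s → i ℤ.+ + k ≡ + j →
            s ^ e * c ^ k ≤ c ^ j
    ^ʳ-L {s} i e {j} {k} (_ , s^d∈L) i+k≡j = ^-cancel-≤ d (^-pos j 0<c) (begin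
      (s ^ e * c ^ k) ^ d            ≡⟨ *-^ (s ^ e) (c ^ k) d ⟩
      (s ^ e) ^ d * (c ^ k) ^ d      ≡⟨ cong₂ _*_ swap (^-^ c k d) ⟩
      (s ^ d) ^ e * c ^ (k ℕ.* d)    ≤⟨ ^ᶻ-L (↥ y) e s^d∈L exponents ⟩
      c ^ (j ℕ.* d)                  ≡⟨ ^-^ c j d ⟨
      (c ^ j) ^ d                    ∎)
      where
      y = i / e
      d = ↧ₙ y
      swap : (s ^ e) ^ d ≡ (s ^ d) ^ e
      swap = trans (^-^ s e d) (trans (cong (s ^_) (ℕ.*-comm e d)) (sym (^-^ s d e)))
      exponents : ↥ y ℤ.* + e ℤ.+ + (k ℕ.* d) ≡ + (j ℕ.* d)
      exponents = E.begin
        ↥ y ℤ.* + e ℤ.+ + (k ℕ.* d)     E.≡⟨ cong₂ ℤ._+_ (↥*n≡i*↧ i e) (ℤ.pos-* k d) ⟩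
        i ℤ.* + d ℤ.+ + k ℤ.* + d       E.≡⟨ ℤ.*-distribʳ-+ (+ d) i (+ k) ⟨
        (i ℤ.+ + k) ℤ.* + d             E.≡⟨ cong (ℤ._* + d) i+k≡j ⟩
        + j ℤ.* + d                     E.≡⟨ ℤ.pos-* j d ⟨
        + (j ℕ.* d)                     E.∎
        where module E = ≡-Reasoning
      open ≤-Reasoning

  -- Fourth powers suit all three factors: the bound on squares of `y ^ⁿ m` is squared once more,
  -- and `b ^ʳ (i / 4)` is handled by `^ʳ-L` with `e` equal to 4.
  product-L : ∀ x y b {a u c q i} → 0ℚ < c → 0ℚ < q →
              x ≤ʳ a → (∀ {s} → L y s → s * s * c ≤ u * u) → b ≤ʳ q → (∀ {s} → U b s → q ≤ s) →
              ∀ m {j k} → i ℤ.+ + k ≡ + j → L (x · y ^ⁿ m · b ^ʳ (i / 4)) p →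
              p ^ 4 * (c ^ m) ^ 2 * q ^ k ≤ a ^ 4 * (u ^ m) ^ 4 * q ^ j
  product-L {p} x y b {a} {u} {c} {q} {i} 0<c 0<q x≤a y-L b≤q q≤b m {j} {k} i+k≡j
    (0<p , w , t , (0<w , e , f , e∈L , f∈L , w≤ef) , t∈L@(0<t , _) , p≤wt) = begin
    p ^ 4 * (c ^ m) ^ 2 * q ^ k
      ≤⟨ *-monoʳ-≤ (q ^ k) (<⇒≤ 0<q^k) (*-monoʳ-≤ ((c ^ m) ^ 2) (<⇒≤ (^-pos 2 0<c^m))
           (^-mono-≤ 4 0<p (≤-trans p≤wt (*-monoʳ-≤ t (<⇒≤ 0<t) w≤ef)))) ⟩
    (e * f * t) ^ 4 * (c ^ m) ^ 2 * q ^ k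
      ≡⟨ regroup e f t (c ^ m) (q ^ k) ⟩
    e ^ 4 * (f * f * c ^ m) ^ 2 * (t ^ 4 * q ^ k)
      ≤⟨ *-mono-≤ (<⇒≤ (*-pos (^-pos 4 0<e) (^-pos 2 0<ffc^m))) (<⇒≤ (*-pos (^-pos 4 0<t) 0<q^k))
           (*-mono-≤ (<⇒≤ (^-pos 4 0<e)) (<⇒≤ (^-pos 2 0<ffc^m))
             (^-mono-≤ 4 0<e (x≤a e∈L))
             (^-mono-≤ 2 0<ffc^m (^ⁿ-L y 0<c y-L m f∈L)))
           (^ʳ-L b 0<q b≤q q≤b i 4 t∈L i+k≡j) ⟩
    a ^ 4 * ((u * u) ^ m) ^ 2 * q ^ j
      ≡⟨ cong (λ z → a ^ 4 * z ^ 2 * q ^ j) (*-^ u u m) ⟩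
    a ^ 4 * (u ^ m * u ^ m) ^ 2 * q ^ j
      ≡⟨ cong (λ z → a ^ 4 * z * q ^ j) (square² (u ^ m)) ⟩
    a ^ 4 * (u ^ m) ^ 4 * q ^ j ∎
    where
    open ≤-Reasoning
    0<e = ℝ⁺.L-pos x e∈L
    0<f = ℝ⁺.L-pos (y ^ⁿ m) f∈L
    0<c^m = ^-pos m 0<c
    0<q^k = ^-pos k 0<q
    0<ffc^m = *-pos (*-pos 0<f 0<f) 0<c^m
    regroup : ∀ x y t c q → (x * y * t) ^ 4 * c ^ 2 * q ≡ x ^ 4 * (y * y * c) ^ 2 * (t ^ 4 * q)
    regroup = solve 5 (λ x y t c q → (x :* y :* t) :^ 4 :* c :^ 2 :* q
                                  := x :^ 4 :* (y :* y :* c) :^ 2 :* (t :^ 4 :* q)) refl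
    square² : ∀ z → (z * z) ^ 2 ≡ z ^ 4
    square² = solve 1 (λ z → (z :* z) :^ 2 := z :^ 4) refl

  /1-homo : ∀ x y z m e k → (+ (x ℕ.^ 4 ℕ.* (y ℕ.^ m) ℕ.^ e ℕ.* z ℕ.^ k)) /1
                          ≡ (+ x) /1 ^ 4 * ((+ y) /1 ^ m) ^ e * (+ z) /1 ^ k
  /1-homo x y z m e k = begin
    (+ (x ℕ.^ 4 ℕ.* (y ℕ.^ m) ℕ.^ e ℕ.* z ℕ.^ k)) /1
      ≡⟨ *-/1 (x ℕ.^ 4 ℕ.* (y ℕ.^ m) ℕ.^ e) (z ℕ.^ k) ⟩
    (+ (x ℕ.^ 4 ℕ.* (y ℕ.^ m) ℕ.^ e)) /1 * (+ (z ℕ.^ k)) /1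
      ≡⟨ cong₂ _*_ (*-/1 (x ℕ.^ 4) ((y ℕ.^ m) ℕ.^ e)) (^-/1 z k) ⟩
    (+ (x ℕ.^ 4)) /1 * (+ ((y ℕ.^ m) ℕ.^ e)) /1 * (+ z) /1 ^ k
      ≡⟨ cong₂ (λ x y → x * y * (+ z) /1 ^ k) (^-/1 x 4) (^-/1 (y ℕ.^ m) e) ⟩
    (+ x) /1 ^ 4 * (+ (y ℕ.^ m)) /1 ^ e * (+ z) /1 ^ k
      ≡⟨ cong (λ y → (+ x) /1 ^ 4 * y ^ e * (+ z) /1 ^ k) (^-/1 y m) ⟩
    (+ x) /1 ^ 4 * ((+ y) /1 ^ m) ^ e * (+ z) /1 ^ k ∎
    where open ≡-Reasoning

  fourth-root-≤ : 0ℚ < t → 0ℚ < c → 0ℚ < s → p ^ 4 * c * s ≤ t ^ 4 * c * s → p ≤ t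
  fourth-root-≤ {c = c} {s = s} 0<t 0<c 0<s h =
    ^-cancel-≤ 4 0<t (*-cancelʳ-≤ c 0<c (*-cancelʳ-≤ s 0<s h))

  -- The inequality `bound` between naturals continues the one of `product-L`. Both ends then share
  -- the powers of `Z` and `Q`, which cancel, and a comparison of fourth powers remains.
  product-≤ʳ : ∀ x y b {X Y Z Q l i} → 0 ℕ.< Z → 0 ℕ.< Q → 0 ℕ.< l →
               x ≤ʳ (+ X) /1 → (∀ {s} → L y s → s * s * (+ Z) /1 ≤ (+ Y) /1 * (+ Y) /1) →
               b ≤ʳ (+ Q) /1 → (∀ {s} → U b s → (+ Q) /1 ≤ s) →
               ∀ m {j k} → i ℤ.+ + k ≡ + j →
               X ℕ.^ 4 ℕ.* (Y ℕ.^ m) ℕ.^ 4 ℕ.* Q ℕ.^ j ℕ.≤ l ℕ.^ 4 ℕ.* (Z ℕ.^ m) ℕ.^ 2 ℕ.* Q ℕ.^ k →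
               x · y ^ⁿ m · b ^ʳ (i / 4) ≤ʳ (+ l) /1
  product-≤ʳ x y b {X} {Y} {Z} {Q} {l} {i} 0<Z 0<Q 0<l x≤X y-L b≤Q Q≤b m {j} {k} i+k≡j bound {p} p∈L =
    fourth-root-≤ {t = (+ l) /1} {c = ((+ Z) /1 ^ m) ^ 2} {s = (+ Q) /1 ^ k} {p = p}
      (/1-pos 0<l) (^-pos 2 (^-pos m (/1-pos 0<Z))) (^-pos k (/1-pos 0<Q)) (begin
        p ^ 4 * ((+ Z) /1 ^ m) ^ 2 * (+ Q) /1 ^ k
          ≤⟨ product-L x y b {i = i} (/1-pos 0<Z) (/1-pos 0<Q) x≤X y-L b≤Q Q≤b m {j} {k} i+k≡j p∈L ⟩
        (+ X) /1 ^ 4 * ((+ Y) /1 ^ m) ^ 4 * (+ Q) /1 ^ j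
          ≡⟨ /1-homo X Y Q m 4 j ⟨
        (+ (X ℕ.^ 4 ℕ.* (Y ℕ.^ m) ℕ.^ 4 ℕ.* Q ℕ.^ j)) /1
          ≤⟨ /1-mono-≤ bound ⟩
        (+ (l ℕ.^ 4 ℕ.* (Z ℕ.^ m) ℕ.^ 2 ℕ.* Q ℕ.^ k)) /1
          ≡⟨ /1-homo l Z Q m 2 k ⟩
        (+ l) /1 ^ 4 * ((+ Z) /1 ^ m) ^ 2 * (+ Q) /1 ^ k ∎)
    where
    open ≤-Reasoning
    /1-pos : ∀ {n} → 0 ℕ.< n → 0ℚ < (+ n) /1
    /1-pos 0<n = i/1>0 (ℤ.+<+ 0<n)

  ι-≤ʳ : ∀ {a b} 0<a → a ≡ b → ι a 0<a ≤ʳ b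
  ι-≤ʳ _ refl (_ , s<a) = <⇒≤ s<a

  ι-U : ∀ {a b} 0<a → a ≡ b → U (ι a 0<a) s → b ≤ s
  ι-U _ refl a<s = <⇒≤ a<s

open import Defs
open import Data.Integer using (ℤ; +_; -_; _+_; _-_; _*_; _≤_) renaming (_^_ to _^ℤ_)
open import Data.Integer.GCD using (gcd)
open import Data.Nat as ℕ using (ℕ; _∸_)
open import Data.Rational as ℚ using (1ℚ; _/_)
open import Relation.Binary.PropositionalEquality using (_≡_)

open import Data.Integer using (+≤+)
open import Data.Integer.Divisibility.Signed using (_∣_; ∣ᵤ⇒∣; ∣⇒∣ᵤ; ∣m+n∣m⇒∣n; ∣m⇒∣m*n; ∣n⇒∣m*n)
open import Data.Integer.Properties using (+-injective; pos-*; *-identityʳ)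
open import Data.Integer.Tactic.RingSolver using (solve-∀)
open import Data.Nat using (suc; z≤n; s≤s)
open import Data.Nat.Coprimality using (Coprime; gcd≡1⇒coprime)
import Data.Nat.Divisibility as ℕ
import Data.Nat.Properties as ℕ
open import Data.Product using (∃₂; _×_; _,_)
import Data.Rational.Properties as ℚ
open import Relation.Binary.PropositionalEquality using (refl; sym; trans; cong; cong₂; subst; subst₂; module ≡-Reasoning)
open CutBounds
open QArithmeticProgression using (coprime-*ʳ; v-+; lcm-lower⁴; lcm≢0)

-- Transfer of the integer hypotheses to the naturals.

pos-^ : ∀ m n → + (m ℕ.^ n) ≡ (+ m) ^ℤ n
pos-^ m ℕ.zero    = refl
pos-^ m (suc n) = trans (pos-* m (m ℕ.^ n)) (cong (λ z → + m * z) (pos-^ m n))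

module _ (q′ a : ℕ) (b : ℤ) (v : ℕ → ℕ) (v≡ : ∀ n → + v n ≡ + a * ((+ suc q′) ^ℤ n) + b) where

  private
    q = suc q′
    r = a ℕ.* q′

  v-suc : ∀ n → v (suc n) ≡ v n ℕ.+ r ℕ.* q ℕ.^ n
  v-suc n = +-injective (begin
    + v (suc n)                           ≡⟨ v≡ (suc n) ⟩
    + a * (+ q * (+ q) ^ℤ n) + b          ≡⟨ expand (+ a) (+ q′) ((+ q) ^ℤ n) b ⟩
    + a * (+ q) ^ℤ n + b + + a * + q′ * (+ q) ^ℤ n
      ≡⟨ cong₂ _+_ (v≡ n) (cong₂ _*_ (pos-* a q′) (pos-^ q n)) ⟨
    + v n + + r * + (q ℕ.^ n)             ≡⟨ cong (λ z → + v n + z) (pos-* r (q ℕ.^ n)) ⟨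
    + v n + + (r ℕ.* q ℕ.^ n)             ∎)
    where
    open ≡-Reasoning
    expand : ∀ a q′ x b → a * ((+ 1 + q′) * x) + b ≡ a * x + b + a * q′ * x
    expand = solve-∀

  module _ (gcd[aq,b]≡1 : gcd (+ a * + q) b ≡ + 1) (gcd[a+b,q-1]≡1 : gcd (+ a + b) (+ q′) ≡ + 1) where

    ∣b∧∣aq⇒≡1 : ∀ {d} → + d ∣ + a * + q → + d ∣ b → d ≡ 1
    ∣b∧∣aq⇒≡1 d∣aq d∣b = gcd≡1⇒coprime (+-injective gcd[aq,b]≡1) (∣⇒∣ᵤ d∣aq , ∣⇒∣ᵤ d∣b)

    ∣v⇒∣b : ∀ {d} n → d ℕ.∣ v n → + d ∣ + a * (+ q) ^ℤ n → + d ∣ b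
    ∣v⇒∣b n d∣v = ∣m+n∣m⇒∣n (subst (_ ∣_) (v≡ n) (∣ᵤ⇒∣ d∣v))

    -- A common divisor divides `a * q ^ suc i`, as the exponent is positive, and therefore `b`; it
    -- also divides `a * q`, which is coprime to `b`.
    v⊥q : ∀ i → Coprime (v (suc i)) q
    v⊥q i {d} (d∣v , d∣q) = ∣b∧∣aq⇒≡1 (∣n⇒∣m*n (+ a) d∣+q)
      (∣v⇒∣b (suc i) d∣v (∣n⇒∣m*n (+ a) (∣m⇒∣m*n ((+ q) ^ℤ i) d∣+q)))
      where
      d∣+q : + d ∣ + q
      d∣+q = ∣ᵤ⇒∣ d∣q

    -- Here `v 0` is a + b and `r` is a(q - 1): the first gcd hypothesis handles the factor `a`, the
    -- second the factor `q′`.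
    v₀⊥r : Coprime (v 0) r
    v₀⊥r = coprime-*ʳ v₀⊥a v₀⊥q′
      where
      v₀⊥a : Coprime (v 0) a
      v₀⊥a {d} (d∣v₀ , d∣a) = ∣b∧∣aq⇒≡1 (∣m⇒∣m*n (+ q) d∣+a) (∣v⇒∣b 0 d∣v₀ (∣m⇒∣m*n (+ 1) d∣+a))
        where
        d∣+a : + d ∣ + a
        d∣+a = ∣ᵤ⇒∣ d∣a
      v₀≡a+b : + v 0 ≡ + a + b
      v₀≡a+b = trans (v≡ 0) (a*1+b≡a+b (+ a) b)
        where
        a*1+b≡a+b : ∀ a b → a * + 1 + b ≡ a + b
        a*1+b≡a+b = solve-∀
      v₀⊥q′ : Coprime (v 0) q′
      v₀⊥q′ = gcd≡1⇒coprime (+-injective (subst (λ z → gcd z (+ q′) ≡ + 1) (sym v₀≡a+b) gcd[a+b,q-1]≡1))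

    -- All terms are congruent to `v 0` modulo `r`, so a common divisor of `v (suc i)` and `r`
    -- divides `v 0`.
    v⊥r : ∀ i → Coprime (v (suc i)) r
    v⊥r i {d} (d∣v , d∣r) = v₀⊥r (ℕ.∣m+n∣m⇒∣n d∣+v₀ d∣rq⁰[i] , d∣r)
      where
      d∣+v₀ = subst (d ℕ.∣_) (trans (v-+ q r v v-suc 0 (suc i)) (ℕ.+-comm (v 0) _)) d∣v
      d∣rq⁰[i] = ℕ.∣m⇒∣m*n _ (ℕ.∣m⇒∣m*n 1 d∣r)

exponent-shift : ∀ m → (+ suc m - + 1) * (+ suc m - + 4) + + (3 ℕ.* m) ≡ + (m ℕ.* m)
exponent-shift m = begin
  (+ suc m - + 1) * (+ suc m - + 4) + + (3 ℕ.* m)  ≡⟨ cong (λ z → (+ suc m - + 1) * (+ suc m - + 4) + z) (pos-* 3 m) ⟩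
  (+ suc m - + 1) * (+ suc m - + 4) + + 3 * + m    ≡⟨ expand (+ m) ⟩
  + m * + m                                        ≡⟨ pos-* m m ⟨
  + (m ℕ.* m)                                      ∎
  where
  open ≡-Reasoning
  expand : ∀ m → (+ 1 + m - + 1) * (+ 1 + m - + 4) + + 3 * m ≡ m * m
  expand = solve-∀

-- The naturals `q₀` and `r` are returned with equations, so that the integers inside the cuts of
-- the final bound need not be split into cases.
lcm-lower⁴ᶻ : ∀ q a b → + 2 ≤ q → + 1 ≤ a → (v : ℕ → ℕ) → (∀ n → + v n ≡ a * (q ^ℤ n) + b) →
              gcd (a * q) b ≡ + 1 → gcd (a + b) (q - + 1) ≡ + 1 →
              ∀ m → let l = lcmUpTo v (suc m) in
              ∃₂ λ q₀ r → q ≡ + q₀ × a * (q - + 1) ≡ + r × 0 ℕ.< q₀ × 0 ℕ.< r × 0 ℕ.< l ×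
                v 1 ℕ.^ 4 ℕ.* (suc r ℕ.^ m) ℕ.^ 4 ℕ.* q₀ ℕ.^ (m ℕ.* m)
                  ℕ.≤ l ℕ.^ 4 ℕ.* (r ℕ.^ m) ℕ.^ 2 ℕ.* q₀ ℕ.^ (3 ℕ.* m)
lcm-lower⁴ᶻ (+ 0) a b (+≤+ ())
lcm-lower⁴ᶻ (+ 1) a b (+≤+ (s≤s ()))
lcm-lower⁴ᶻ (+ suc q′@(suc _)) (+ 0) b q≥2 (+≤+ ())
lcm-lower⁴ᶻ (+ q@(suc q′@(suc _))) (+ a@(suc _)) b _ _ v v≡ gcd[aq,b]≡1 gcd[a+b,q-1]≡1 m =
  q , r , refl , sym (pos-* a q′) , s≤s z≤n , 1≤r
  , ℕ.>-nonZero⁻¹ _ {{lcm≢0 q r v v-suc′ v⊥r′ v⊥q′ 2≤q 1≤r (suc m)}}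
  , lcm-lower⁴ q r v v-suc′ v⊥r′ v⊥q′ 2≤q 1≤r m
  where
  r = a ℕ.* q′
  v-suc′ = v-suc q′ a b v v≡
  v⊥r′ = v⊥r q′ a b v v≡ gcd[aq,b]≡1 gcd[a+b,q-1]≡1
  v⊥q′ = v⊥q q′ a b v v≡ gcd[aq,b]≡1 gcd[a+b,q-1]≡1
  2≤q : 2 ℕ.≤ q
  2≤q = s≤s (s≤s z≤n)
  1≤r : 1 ℕ.≤ r
  1≤r = s≤s z≤n

corollary1p4 : (q a b : ℤ) (q≥2 : + 2 ≤ q) (a≥1 : + 1 ≤ a) (b≥-a : - a ≤ b) →
    (v : ℕ → ℕ) → (∀ n → + v n ≡ a * (q ^ℤ n) + b) →
    gcd (a * q) b ≡ + 1 → gcd (a + b) (q - + 1) ≡ + 1 →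
    (n : ℕ) → 1 ℕ.≤ n →
    let open Bound q a b q≥2 a≥1 b≥-a in
    ιᶻ (a * q + b) aq+b>0
    · (ιᶻ (a * (q - + 1) + + 1) a[q-1]+1>0
    ÷ʳ (√ (ιᶻ (a * (q - + 1)) a[q-1]>0) · ι (A′ ℚ.+ 1ℚ) A′+1>0)) ^ⁿ (n ∸ 1)
    · ιᶻ q q>0 ^ʳ (((+ n - + 1) * (+ n - + 4)) / 4)
    ≤ʳ (+ lcmUpTo v n) /1
corollary1p4 q a b q≥2 a≥1 b≥-a v v≡ gcd[aq,b]≡1 gcd[a+b,q-1]≡1 (suc m) _ p∈L =
  let open Bound q a b q≥2 a≥1 b≥-a
      (q₀ , r , q≡ , a[q-1]≡r , 0<q , 0<r , 0<l , bound) =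
        lcm-lower⁴ᶻ q a b q≥2 a≥1 v v≡ gcd[aq,b]≡1 gcd[a+b,q-1]≡1 m
      aq+b≡v₁ = trans (cong (λ z → a * z + b) (sym (*-identityʳ q))) (sym (v≡ 1))
      a[q-1]+1≡1+r = trans (cong (_+ + 1) a[q-1]≡r) (cong +_ (ℕ.+-comm r 1))
      -- A′ is a maximum with 0, hence nonnegative; this is the condition `1 ≤ d` of `quotient-L`.
      1≤A′+1 = ℚ.+-monoˡ-≤ 1ℚ (ℚ.p≤p⊔q ℚ.0ℚ b/2a+1/2a[q-1])
  -- Spelling out the two reals left as _ would make Agda compare nested cut
  -- records field by field, proofs included, which does not finish in reasonable time.
  in product-≤ʳ (ιᶻ (a * q + b) aq+b>0) _ _
       {v 1} {suc r} {r} {q₀} {lcmUpTo v (suc m)} {(+ suc m - + 1) * (+ suc m - + 4)}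
       0<r 0<q 0<l
       (ι-≤ʳ (i/1>0 aq+b>0) (cong _/1 aq+b≡v₁))
       (λ {s} s∈L → subst₂ (λ z u → s ℚ.* s ℚ.* z ℚ.≤ u ℚ.* u) (cong _/1 a[q-1]≡r) (cong _/1 a[q-1]+1≡1+r)
         (quotient-L (i/1>0 a[q-1]+1>0) (i/1>0 a[q-1]>0) A′+1>0 1≤A′+1 s∈L))
       (ι-≤ʳ (i/1>0 q>0) (cong _/1 q≡)) (ι-U (i/1>0 q>0) (cong _/1 q≡))
       m {m ℕ.* m} {3 ℕ.* m} (exponent-shift m) bound p∈L
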